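{- Let $d\ge 2$ be a fixed integer. \begin{itemize} \item If $d$ is even, then any deterministic distributed algorithm in the LOCAL model that guarantees a constant factor approximation for MaxCut on the class of bipartite $d$-regular $n$-vertex graphs runs in $\Omega(\log^* n)$ rounds. \item If $d$ is odd, then for any $\epsilon>0$, any deterministic $\left(\frac{1}{d}+\epsilon\right)$-approximation algorithm in the LOCAL model for MaxCut on the class of bipartite $d$-regular $n$-vertex graphs runs in $\Omega(\log^* n)$ rounds. \end{itemize}
   Context: A cut of a graph $G$ is a bipartition $(A,B)$ of $V(G)$; its size is the number of edges with one end in $A$ and the other in $B$. MaxCut asks for a cut of maximum size. An algorithm is a $\rho$-approximation (guarantees approximation ratio $\rho$) on a class of graphs if on every graph of the class it outputs a cut of size at least $\rho$ times the maximum cut size; a constant factor approximation is a $\rho$-approximation for some fixed constant $\rho>0$. LOCAL model: each vertex of an $n$-vertex graph is a processor with unbounded computational power and a unique ID, an integer between $1$ and $\mathrm{poly}(n)$; in synchronous rounds each vertex sends messages of unbounded size to its neighbors, and at the end each vertex outputs $0$ or $1$ (its side of the cut). The iterated logarithm $\log^* n$ is $0$ if $n\le 1$ and $1+\log^*(\log_2 n)$ otherwise. -}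

module Defs where

open import Data.Nat using (ℕ; zero; suc; _+_; _*_; _^_; _<ᵇ_; _<?_)
import Data.Nat as ℕ
open import Data.Integer using (+_)
open import Data.Fin using (Fin; toℕ)
open import Data.Bool using (Bool; true; false; _∧_; _xor_)
open import Data.List using (List; []; _∷_; map; allFin; upTo; length; filter)
open import Data.Nat.ListAction using (sum)
open import Data.Product using (Σ; _×_; ∃)
open import Data.Sum using (_⊎_)
open import Data.Empty using (⊥)
open import Relation.Binary.PropositionalEquality using (_≡_; _≢_)
open import Data.Rational as ℚ using (ℚ; 0ℚ)
open import Function.Definitions using (Injective)

-- iterated logarithm: log* n = least k with n ≤ tower k, where tower 0 = 1,
-- tower (k+1) = 2 ^ tower k.  Equivalently the number of k with tower k < n
-- (all such k are < n).
tower : ℕ → ℕ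
tower zero    = 1
tower (suc k) = 2 ^ tower k

logStar : ℕ → ℕ
logStar n = length (filter (λ k → tower k <? n) (upTo n))

countTrue : List Bool → ℕ
countTrue []           = 0
countTrue (true ∷ bs)  = suc (countTrue bs)
countTrue (false ∷ bs) = countTrue bs

record Graph (n : ℕ) : Set where
  field
    adj    : Fin n → Fin n → Bool
    sym    : ∀ u v → adj u v ≡ adj v u
    irrefl : ∀ v → adj v v ≡ false
open Graph public

degree : ∀ {n} → Graph n → Fin n → ℕ
degree {n} G v = countTrue (map (adj G v) (allFin n))

Regular : ∀ {n} → ℕ → Graph n → Set
Regular d G = ∀ v → degree G v ≡ d

Bipartite : ∀ {n} → Graph n → Set
Bipartite {n} G = Σ (Fin n → Bool) λ col → ∀ u v → adj G u v ≡ true → col u ≢ col v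

InClass : ∀ {n} → ℕ → Graph n → Set
InClass d G = Bipartite G × Regular d G

Cut : ℕ → Set
Cut n = Fin n → Bool

cutSize : ∀ {n} → Graph n → Cut n → ℕ
cutSize {n} G S =
  sum (map (λ u → countTrue (map (λ v → adj G u v ∧ (toℕ u <ᵇ toℕ v) ∧ (S u xor S v)) (allFin n))) (allFin n))

record IdAssignment (n c : ℕ) : Set where
  field
    ident : Fin n → ℕ
    inj   : Injective _≡_ _≡_ ident
    lower : ∀ v → 1 ℕ.≤ ident v
    upper : ∀ v → ident v ℕ.≤ n ^ c
open IdAssignment public

Within : ∀ {n} → Graph n → ℕ → Fin n → Fin n → Set
Within G zero    v u = v ≡ u
Within G (suc k) v u = Within G k v u ⊎ ∃ λ w → Within G k v w × adj G w u ≡ true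

Near : ∀ {n} → Graph n → ℕ → Fin n → Fin n → Set
Near G zero    v u = ⊥
Near G (suc r) v u = Within G r v u

-- (G, id, v) and (G', id', v') have the same view after r rounds of the LOCAL
-- model: same own ID, same set of IDs within distance r, and the same
-- adjacency (between ID-labelled vertices) for every edge incident to a
-- vertex at distance < r.
SameView : ∀ {n c} → ℕ →
           Graph n → IdAssignment n c → Fin n →
           Graph n → IdAssignment n c → Fin n → Set
SameView {n} r G ι v G' ι' v' =
  (ident ι v ≡ ident ι' v')
  × (∀ u → Within G r v u → ∃ λ u' → ident ι' u' ≡ ident ι u × Within G' r v' u')
  × (∀ u' → Within G' r v' u' → ∃ λ u → ident ι u ≡ ident ι' u' × Within G r v u)
  × (∀ u w u' w' → ident ι u ≡ ident ι' u' → ident ι w ≡ ident ι' w' →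
       Near G r v u ⊎ Near G' r v' u' → adj G u w ≡ adj G' u' w')

record LocalAlg (d c n r : ℕ) : Set where
  field
    out   : Graph n → IdAssignment n c → Cut n
    local : ∀ G ι v G' ι' v' → InClass d G → InClass d G' →
            SameView r G ι v G' ι' v' → out G ι v ≡ out G' ι' v'
open LocalAlg public

toℚ : ℕ → ℚ
toℚ m = + m ℚ./ 1

Approx : ∀ {d c n r} → ℚ → LocalAlg d c n r → Set
Approx {d} {c} {n} ρ A =
  ∀ (G : Graph n) (ι : IdAssignment n c) → InClass d G →
  ∀ (S : Cut n) → ρ ℚ.* toℚ (cutSize G S) ℚ.≤ toℚ (cutSize G (out A G ι))

-- Ω(log* n) round lower bound for ρ-approximations (IDs in 1..n^c):
-- there are K and n₀ such that for all even n ≥ n₀ (the class is empty for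
-- odd n), every r-round algorithm that is a ρ-approximation satisfies
-- log* n ≤ K · r.
RoundLowerBound : ℕ → ℕ → ℚ → Set
RoundLowerBound d c ρ =
  ∃ λ K → ∃ λ n₀ → ∀ n → n₀ ℕ.≤ n → n ℕ.% 2 ≡ 0 →
  ∀ r (A : LocalAlg d c n r) → Approx ρ A → logStar n ℕ.≤ K * r

-- 1/d as a rational (d ≥ 2 in use)
recip : ℕ → ℚ
recip zero    = 0ℚ
recip (suc k) = + 1 ℚ./ suc k

{-# OPTIONS --safe #-}

-- Write d = 2e + δ and n = 2h.  The graph is a ladder with h rungs closed up
-- into a prism (h even) or a Möbius ladder (h odd); along the two rails every
-- vertex is joined to the vertices at odd distance below 2e, and the rungs are
-- edges exactly when δ = 1.  An r-round algorithm sees, from a vertex, only the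
-- identifiers on a window of O(r) consecutive rungs.  Identifiers are handed
-- out to rungs in pairs, so the algorithm colours tuples of pairs by the
-- outputs of the two vertices in the middle of a window.  The chromatic number
-- of shift graphs on N points is an iterated logarithm of N; applied to the
-- vector of colours of the windows of a long tuple, this yields, from any pool
-- of tower(O(r)) pairs, a long increasing sequence on which all windows have
-- the same colour.  Extracting such sequences greedily and laying them out one
-- after the other, only the rungs are cut away from the seams, that is about
-- δ·h edges out of the d·h edges cut by the bipartition.
module Submission where

open import Defs hiding (sym)
open import Data.Nat
open import Data.Nat.Properties
open import Data.Nat.DivMod using (m≡m%n+[m/n]*n; m%n<n)
open import Data.Nat.ListAction using (sum)
open import Data.Nat.ListAction.Properties using (sum-↭; sum-++)
open import Data.Nat.Tactic.RingSolver using (solve-∀)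
import Data.Integer as ℤ
import Data.Integer.Properties as ℤ
open import Data.Rational as ℚ using (ℚ; 0ℚ; mkℚ; toℚᵘ)
import Data.Rational.Properties as ℚ
open import Data.Rational.Unnormalised as ℚᵘ using (mkℚᵘ; *≤*; *≡*)
import Data.Rational.Unnormalised.Properties as ℚᵘ
open import Data.Fin as F using (Fin; zero; suc; toℕ; fromℕ; fromℕ<; inject₁; combine; remQuot; finToFun; funToFin)
import Data.Fin.Properties as F
open import Data.Bool using (Bool; true; false; _∧_; _xor_; not; if_then_else_)
open import Data.Bool.Properties using (⇔→≡; not-¬; not-involutive; ∧-identityʳ; xor-comm; xor-assoc; xor-same; xor-identityʳ; xor-inverseʳ; not-distribˡ-xor; not-distribʳ-xor)
open import Data.Product using (_×_; ∃; _,_; proj₁; proj₂)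
open import Data.Sum using (_⊎_; inj₁; inj₂)
open import Data.List using (List; []; _∷_; _∷ʳ_; _++_; map; allFin; applyUpTo; length; filter; take; drop; lookup)
open import Data.List.Properties using (length-map; length-++; length-take; length-tabulate; map-cong; map-++; map-applyUpTo; take-map; drop-map; take++drop≡id; ++-assoc; ++-identityʳ)
open import Data.List.Membership.Propositional using (_∈_; _∉_)
open import Data.List.Membership.Propositional.Properties using (∈-filter⁺; ∈-filter⁻; ∈-allFin; ∈-++⁺ˡ; ∈-++⁺ʳ; ∈-++⁻; ∈-lookup; ∈-map⁺; ∈-map⁻; ∈-applyUpTo⁺; ∈-applyUpTo⁻)
open import Data.List.Membership.Propositional.Properties.WithK using (unique∧set⇒bag)
open import Data.List.Relation.Binary.BagAndSetEquality using (∼bag⇒↭)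
open import Data.List.Relation.Binary.Disjoint.Propositional using (Disjoint)
open import Data.List.Relation.Binary.Permutation.Propositional using (_↭_)
import Data.List.Relation.Binary.Permutation.Propositional.Properties as Perm
open import Data.List.Relation.Unary.All as All using (All; []; _∷_)
import Data.List.Relation.Unary.All.Properties as All
import Data.List.Relation.Unary.AllPairs as AllPairs
open import Data.List.Relation.Unary.Any using (here; there)
open import Data.List.Relation.Unary.Linked using (Linked; []; [-]; _∷_; linked?)
open import Data.List.Relation.Unary.Linked.Properties using (Linked⇒AllPairs)
open import Data.List.Relation.Unary.Unique.Propositional using (Unique; []; _∷_)
import Data.List.Relation.Unary.Unique.Propositional.Properties as Unique
open import Algebra.Properties.CommutativeSemigroup +-commutativeSemigroup using (interchange; x∙yz≈y∙xz)
open import Function using (_∘_; id; mk⇔)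
open import Relation.Nullary using (¬_; Dec; yes; no; does; contradiction; ¬?)
open import Relation.Nullary.Decidable using (_×-dec_; dec-true; dec-false)
open import Relation.Unary using (Decidable)
open import Relation.Binary.Definitions using (tri<; tri≈; tri>)
open import Relation.Binary.PropositionalEquality

-- The iterated logarithm

-- An algorithm only ever sees windows of consecutive rungs, so colours must agree along one
-- sequence and not on all its subsets; this is why shift graphs can stand in for Ramsey's theorem.
-- An init and a tail of equal colour are a single coincidence; the vector colouring turns it into a
-- chain of them. A window colour records both ends of the middle rung, and shifts keep to one rail
-- inside a segment. On a homogeneous stretch each rail therefore has constant output and no shift
-- edge is cut, but a rung may join different outputs. Two kinds of rungs escape control. At each
-- end of a segment about `r * (e + e)` rungs have incomplete windows or neighbours there; segments
-- longer than these margins by a factor of order `q`, where `1/q` is the precision wanted, make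
-- them negligible. After the last extraction a pool too small to continue may remain; its size is a
-- tower of height linear in `r`, negligible once `n` is large and `logStar n` exceeds a suitable
-- multiple of `r`.

length-filter-applyUpTo : ∀ {A : Set} {P : A → Set} (P? : Decidable P) (f : ℕ → A) n k →
  (∀ {j} → P (f j) → j < k) → length (filter P? (applyUpTo f n)) ≤ k
length-filter-applyUpTo P? f zero k b = z≤n
length-filter-applyUpTo P? f (suc n) k b with P? (f 0)
length-filter-applyUpTo P? f (suc n) k b | no _ =
  length-filter-applyUpTo P? (f ∘ suc) n k (λ q → ≤-trans (n≤1+n _) (b q))
length-filter-applyUpTo P? f (suc n) zero b | yes p₀ = contradiction (b p₀) λ ()
length-filter-applyUpTo P? f (suc n) (suc k) b | yes _ =
  s≤s (length-filter-applyUpTo P? (f ∘ suc) n k (λ q → s≤s⁻¹ (b q)))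

tower-mono : ∀ {i j} → i ≤ j → tower i ≤ tower j
tower-mono {j = j} z≤n = 1≤tower j
  where
  1≤tower : ∀ j → 1 ≤ tower j
  1≤tower zero    = ≤-refl
  1≤tower (suc j) = m^n>0 2 (tower j)
tower-mono (s≤s i≤j) = ^-monoʳ-≤ 2 (tower-mono i≤j)

-- By monotonicity of `tower` the indices counted by `logStar n` are downward closed. If
-- `n ≤ tower k`, they all lie below `k`, so at most `k` of them are counted.
tower<-of-<logStar : ∀ {k n} → k < logStar n → tower k < n
tower<-of-<logStar {k} {n} k< with tower k <? n
... | yes t = t
... | no ¬t = contradiction k< (≤⇒≯ (length-filter-applyUpTo (λ j → tower j <? n) id n k below))
  where
  below : ∀ {j} → tower j < n → j < k
  below {j} tj<n with j <? k
  ... | yes q = q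
  ... | no ¬q = contradiction (<-≤-trans tj<n (≤-trans (≮⇒≥ ¬t) (tower-mono (≮⇒≥ ¬q)))) (<-irrefl refl)

n<2^n : ∀ n → n < 2 ^ n
n<2^n zero    = s≤s z≤n
n<2^n (suc n) = begin-strict
  suc n             <⟨ s≤s (n<2^n n) ⟩
  1 + 2 ^ n         ≤⟨ +-monoˡ-≤ (2 ^ n) (m^n>0 2 n) ⟩
  2 ^ n + 2 ^ n     ≡⟨ cong (2 ^ n +_) (+-identityʳ (2 ^ n)) ⟨
  2 ^ suc n         ∎
  where open ≤-Reasoning

n<tower : ∀ n → n < tower n
n<tower zero    = s≤s z≤n
n<tower (suc n) = ≤-<-trans (n<tower n) (n<2^n (tower n))

-- Colourings of increasing tuples

-- The exponential acts on the argument, not on the result, to match the induction on arity, where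
-- each step replaces `c` colours by `2 ^ c`.
iterExp : ℕ → ℕ → ℕ
iterExp zero    c = c
iterExp (suc j) c = iterExp j (2 ^ c)

iterExp-tower : ∀ j {c i} → c ≤ tower i → iterExp j c ≤ tower (j + i)
iterExp-tower zero    le = le
iterExp-tower (suc j) {c} {i} le =
  subst (λ k → iterExp j (2 ^ c) ≤ tower k) (+-suc j i) (iterExp-tower j (^-monoʳ-≤ 2 le))

Linked-replace-tail : ∀ {A : Set} {R : A → A → Set} {x y : A} {xs zs} →
  Linked R (x ∷ y ∷ xs) → Linked R (y ∷ zs) → Linked R (x ∷ y ∷ zs)
Linked-replace-tail (r ∷ _) l = r ∷ l

extendsLeft? : ∀ {N c} (χ : List (Fin N) → Fin c) xs i →
  Dec (∃ λ x → Linked F._<_ (x ∷ xs) × χ (x ∷ xs) ≡ i)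
extendsLeft? χ xs i = F.any? (λ x → linked? F._<?_ (x ∷ xs) ×-dec (χ (x ∷ xs) F.≟ i))

-- A set of colours as a map into `Fin 2`, so that `funToFin` makes it one of `2 ^ c` colours.
leftColours : ∀ {N c} → (List (Fin N) → Fin c) → List (Fin N) → Fin c → Fin 2
leftColours χ xs i = if does (extendsLeft? χ xs i) then suc zero else zero

-- Lowering the arity by one exponentiates the number of colours: a tuple is
-- recoloured by the set of colours of its extensions to the left.
init-tail-monochromatic : ∀ {N} k {c} (χ : List (Fin N) → Fin c) → iterExp k c < N →
  ∃ λ x → ∃ λ ys → ∃ λ w → length ys ≡ k × Linked F._<_ (x ∷ ys ∷ʳ w) × χ (x ∷ ys) ≡ χ (ys ∷ʳ w)
init-tail-monochromatic zero χ c<N with F.pigeonhole c<N (λ i → χ (i ∷ []))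
... | i , j , i<j , eq = i , [] , j , refl , i<j ∷ [-] , eq
init-tail-monochromatic (suc k) χ lt
  with init-tail-monochromatic k (funToFin ∘ leftColours χ) lt
... | x , ys , w , len , lnk , eq
  with extendsLeft? χ (x ∷ ys) (χ (x ∷ ys ∷ʳ w)) | extendsLeft? χ (ys ∷ʳ w) (χ (x ∷ ys ∷ʳ w)) | same
  where
  same : leftColours χ (x ∷ ys) (χ (x ∷ ys ∷ʳ w)) ≡ leftColours χ (ys ∷ʳ w) (χ (x ∷ ys ∷ʳ w))
  same = trans (sym (F.finToFun-funToFin (leftColours χ (x ∷ ys)) _))
         (trans (cong (λ f → finToFun f (χ (x ∷ ys ∷ʳ w))) eq)
                (F.finToFun-funToFin (leftColours χ (ys ∷ʳ w)) _))
-- The entry `x` puts the colour of `x ∷ ys ∷ʳ w` into the left set of `ys ∷ʳ w`, hence by `eq` into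
-- that of `x ∷ ys`; the witness `x₀` found there is the new first entry.
... | yes (x₀ , l , e) | _     | _ = x₀ , x ∷ ys , w , cong suc len , Linked-replace-tail l lnk , e
... | no _             | no ¬e | _ = contradiction (x , lnk , refl) ¬e
... | no _             | yes _ | ()

-- Lists without repetition

unique∧⇔⇒↭ : ∀ {A : Set} {xs ys : List A} → Unique xs → Unique ys →
  (∀ {z} → z ∈ xs → z ∈ ys) → (∀ {z} → z ∈ ys → z ∈ xs) → xs ↭ ys
unique∧⇔⇒↭ u v f g = ∼bag⇒↭ (unique∧set⇒bag u v (mk⇔ f g))

lookup-injective : ∀ {A : Set} {xs : List A} → Unique xs →
  ∀ {i j} → lookup xs i ≡ lookup xs j → i ≡ j
lookup-injective {xs = _ ∷ _} _ {zero} {zero} _ = refl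
lookup-injective {xs = _ ∷ _} (x≢ ∷ _) {zero} {suc j} eq = contradiction eq (All.lookup x≢ (∈-lookup j))
lookup-injective {xs = _ ∷ _} (x≢ ∷ _) {suc i} {zero} eq = contradiction (sym eq) (All.lookup x≢ (∈-lookup i))
lookup-injective {xs = _ ∷ _} (_ ∷ u) {suc i} {suc j} eq = cong suc (lookup-injective u eq)

-- A default keeps indices in ℕ, where positions are sums; on a list of length `h`, read at
-- positions below `h`, it is never returned.
nth : {A : Set} → A → List A → ℕ → A
nth d []       _       = d
nth d (x ∷ xs) zero    = x
nth d (x ∷ xs) (suc i) = nth d xs i

nth-∈ : ∀ {A : Set} (d : A) xs {i} → i < length xs → nth d xs i ∈ xs
nth-∈ d (x ∷ xs) {zero}  _       = here refl
nth-∈ d (x ∷ xs) {suc i} (s≤s l) = there (nth-∈ d xs l)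

nth-injective : ∀ {A : Set} (d : A) {xs} → Unique xs → ∀ {i j} →
  i < length xs → j < length xs → nth d xs i ≡ nth d xs j → i ≡ j
nth-injective d (_ ∷ _) {zero} {zero} _ _ _ = refl
nth-injective d {_ ∷ xs} (x≢ ∷ _) {zero} {suc j} _ (s≤s l) eq = contradiction eq (All.lookup x≢ (nth-∈ d xs l))
nth-injective d {_ ∷ xs} (x≢ ∷ _) {suc i} {zero} (s≤s l) _ eq = contradiction (sym eq) (All.lookup x≢ (nth-∈ d xs l))
nth-injective d (_ ∷ u) {suc i} {suc j} (s≤s l) (s≤s l') eq = cong suc (nth-injective d u l l' eq)

nth-++ʳ : ∀ {A : Set} (d : A) xs {ys} i → nth d (xs ++ ys) (length xs + i) ≡ nth d ys i
nth-++ʳ d []       i = refl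
nth-++ʳ d (_ ∷ xs) i = nth-++ʳ d xs i

nth-++ˡ : ∀ {A : Set} (d : A) xs {ys} {i} → i < length xs → nth d (xs ++ ys) i ≡ nth d xs i
nth-++ˡ d (_ ∷ xs) {i = zero}  _       = refl
nth-++ˡ d (_ ∷ xs) {i = suc i} (s≤s l) = nth-++ˡ d xs l

length-take-≤ : ∀ {A : Set} n (xs : List A) → n ≤ length xs → length (take n xs) ≡ n
length-take-≤ n xs le = trans (length-take n xs) (m≤n⇒m⊓n≡m le)

length-drop-+ : ∀ {A : Set} i {n} (xs : List A) → i + n ≤ length xs → n ≤ length (drop i xs)
length-drop-+ zero    xs       le       = le
length-drop-+ (suc i) (x ∷ xs) (s≤s le) = length-drop-+ i xs le

take-++ : ∀ {A : Set} n (xs ys : List A) → n ≤ length xs → take n (xs ++ ys) ≡ take n xs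
take-++ zero    xs       ys _        = refl
take-++ (suc n) (x ∷ xs) ys (s≤s le) = cong (x ∷_) (take-++ n xs ys le)

drop-++ : ∀ {A : Set} n (xs ys : List A) → n ≤ length xs → drop n (xs ++ ys) ≡ drop n xs ++ ys
drop-++ zero    xs       ys _        = refl
drop-++ (suc n) (x ∷ xs) ys (s≤s le) = drop-++ n xs ys le

window : {A : Set} → ℕ → ℕ → List A → List A
window W i xs = take W (drop i xs)

window-split : ∀ {A : Set} W i (xs : List A) →
  xs ≡ take i xs ++ window W i xs ++ drop W (drop i xs)
window-split W i xs = sym (trans (cong (take i xs ++_) (take++drop≡id W (drop i xs))) (take++drop≡id i xs))

window-++ : ∀ {A : Set} W i (xs ys : List A) → i + W ≤ length xs → window W i (xs ++ ys) ≡ window W i xs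
window-++ W i xs ys le = trans (cong (take W) (drop-++ i xs ys (m+n≤o⇒m≤o i le)))
  (take-++ W (drop i xs) ys (length-drop-+ i xs le))

window-map : ∀ {A B : Set} (f : A → B) W i xs → window W i (map f xs) ≡ map f (window W i xs)
window-map f W i xs = trans (cong (take W) (drop-map i xs)) (take-map W (drop i xs))

-- Colouring a long tuple by the vector of the colours of its windows makes all
-- windows agree as soon as its init and its tail have the same colour.
module _ {N q : ℕ} (χ : List (Fin N) → Fin q) (W m : ℕ) where

  windowColours : List (Fin N) → Fin (suc m) → Fin q
  windowColours xs i = χ (window (suc W) (toℕ i) xs)

  windows-monochromatic : iterExp (W + m) (q ^ suc m) < N →
    ∃ λ xs → length xs ≡ suc (suc (W + m)) × Linked F._<_ xs ×
      (∀ {i} → i ≤ suc m → χ (window (suc W) i xs) ≡ χ (window (suc W) 0 xs))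
  windows-monochromatic lt with init-tail-monochromatic (W + m) (funToFin ∘ windowColours) lt
  ... | x , ys , w , len , lnk , eq = x ∷ ys ∷ʳ w , len' , lnk , const
    where
    len' : length (x ∷ ys ∷ʳ w) ≡ suc (suc (W + m))
    len' = cong suc (trans (length-++ ys) (trans (+-comm (length ys) 1) (cong suc len)))
    -- Window `i` of the tail is by definition window `i + 1` of the whole tuple, and `i ≤ m` keeps
    -- the last entry out of window `i`. Equality of the two colour vectors thus links neighbouring
    -- windows.
    step : ∀ {i} → i ≤ m → χ (window (suc W) i (x ∷ ys ∷ʳ w)) ≡ χ (window (suc W) (suc i) (x ∷ ys ∷ʳ w))
    step {i} i≤m = begin
      χ (window (suc W) i (x ∷ ys ∷ʳ w))   ≡⟨ cong χ (window-++ (suc W) i (x ∷ ys) (w ∷ []) fits) ⟩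
      χ (window (suc W) i (x ∷ ys))        ≡⟨ cong (λ k → χ (window (suc W) k (x ∷ ys))) (F.toℕ-fromℕ< (s≤s i≤m)) ⟨
      windowColours (x ∷ ys) j             ≡⟨ F.finToFun-funToFin (windowColours (x ∷ ys)) j ⟨
      finToFun (funToFin (windowColours (x ∷ ys))) j  ≡⟨ cong (λ f → finToFun f j) eq ⟩
      finToFun (funToFin (windowColours (ys ∷ʳ w))) j ≡⟨ F.finToFun-funToFin (windowColours (ys ∷ʳ w)) j ⟩
      windowColours (ys ∷ʳ w) j            ≡⟨ cong (λ k → χ (window (suc W) k (ys ∷ʳ w))) (F.toℕ-fromℕ< (s≤s i≤m)) ⟩
      χ (window (suc W) i (ys ∷ʳ w))       ∎
      where
      open ≡-Reasoning
      j : Fin (suc m)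
      j = fromℕ< (s≤s i≤m)
      fits : i + suc W ≤ suc (length ys)
      fits = subst₂ _≤_ (sym (+-suc i W)) (cong suc (trans (+-comm m W) (sym len))) (s≤s (+-monoˡ-≤ W i≤m))
    const : ∀ {i} → i ≤ suc m → χ (window (suc W) i (x ∷ ys ∷ʳ w)) ≡ χ (window (suc W) 0 (x ∷ ys ∷ʳ w))
    const {zero}  _         = refl
    const {suc i} (s≤s i≤m) = trans (sym (step i≤m)) (const (m≤n⇒m≤1+n i≤m))

-- Completing a list to a permutation

module _ {n : ℕ} where

  open import Data.List.Membership.DecPropositional (F._≟_ {n}) using (_∈?_)

  complement : List (Fin n) → List (Fin n)
  complement xs = filter (λ z → ¬? (z ∈? xs)) (allFin n)

  -- An assignment of identifiers must cover all rungs; keeping `xs` as a prefix preserves its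
  -- positions.
  complete : List (Fin n) → List (Fin n)
  complete xs = xs ++ complement xs

  complement-unique : ∀ xs → Unique (complement xs)
  complement-unique xs = Unique.filter⁺ (λ z → ¬? (z ∈? xs)) (Unique.allFin⁺ n)

  ∈-complement⁻ : ∀ xs {z} → z ∈ complement xs → z ∉ xs
  ∈-complement⁻ xs z∈ = proj₂ (∈-filter⁻ (λ z → ¬? (z ∈? xs)) {xs = allFin n} z∈)

  complete-unique : ∀ {xs} → Unique xs → Unique (complete xs)
  complete-unique {xs} u =
    Unique.++⁺ u (complement-unique xs) (λ (z∈ , z∈ᶜ) → ∈-complement⁻ xs z∈ᶜ z∈)

  complete-↭ : ∀ {xs} → Unique xs → complete xs ↭ allFin n
  complete-↭ {xs} u = unique∧⇔⇒↭ (complete-unique u) (Unique.allFin⁺ n) (λ {z} _ → ∈-allFin z) full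
    where
    full : ∀ {z} → z ∈ allFin n → z ∈ complete xs
    full {z} z∈ with z ∈? xs
    ... | yes p = ∈-++⁺ˡ p
    ... | no ¬p = ∈-++⁺ʳ xs (∈-filter⁺ (λ z → ¬? (z ∈? xs)) z∈ ¬p)

  length-complete : ∀ {xs} → Unique xs → length (complete xs) ≡ n
  length-complete u = trans (Perm.↭-length (complete-↭ u)) (length-tabulate id)

  length-complement : ∀ {xs} → Unique xs → length xs + length (complement xs) ≡ n
  length-complement {xs} u = trans (sym (length-++ xs)) (length-complete u)

  -- Greedy extraction of pairwise disjoint homogeneous segments
  module Segments {q : ℕ} (χ : List (Fin n) → Fin q) (W m : ℕ) where

    -- Room for windows of length `W + 1` at the starting points `0` to `m + 1`.
    segmentLength : ℕ
    segmentLength = suc (suc (W + m))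

    poolSize : ℕ
    poolSize = suc (iterExp (W + m) (q ^ suc m))

    record Segment (xs : List (Fin n)) : Set where
      field
        len    : length xs ≡ segmentLength
        homog  : ∀ {i} → i ≤ suc m → χ (window (suc W) i xs) ≡ χ (window (suc W) 0 xs)

    record SegmentAt (o : ℕ) (P : List (Fin n)) : Set where
      field
        before seg after : List (Fin n)
        split   : P ≡ before ++ seg ++ after
        offset  : length before ≡ o
        segment : Segment seg

    extract : ∀ {P} → Unique P → length P + poolSize ≤ n → ∃ λ xs → Unique (P ++ xs) × Segment xs
    extract {P} u le with windows-monochromatic (χ ∘ map (lookup (complement P))) W m room
      where
      room : poolSize ≤ length (complement P)
      room = +-cancelˡ-≤ (length P) _ _ (≤-trans le (≤-reflexive (sym (length-complement u))))
    ... | zs , len , lnk , hom = map (lookup pool) zs , uniq , record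
        { len = trans (length-map (lookup pool) zs) len
        ; homog = λ {i} i≤ → trans (cong χ (window-map (lookup pool) (suc W) i zs))
                    (trans (hom i≤) (cong χ (sym (window-map (lookup pool) (suc W) 0 zs)))) }
      where
      pool : List (Fin n)
      pool = complement P
      disj : Disjoint P (map (lookup pool) zs)
      disj (z∈P , z∈) with ∈-map⁻ (lookup pool) z∈
      ... | i , _ , refl = ∈-complement⁻ P (∈-lookup i) z∈P
      uniq : Unique (P ++ map (lookup pool) zs)
      uniq = Unique.++⁺ u (Unique.map⁺ (lookup-injective (complement-unique P))
        (AllPairs.map (λ i<j → F.<⇒≢ i<j) (Linked⇒AllPairs F.<-trans lnk))) disj

    segments : ∀ t → t * segmentLength + poolSize ≤ n →
      ∃ λ P → Unique P × length P ≡ t * segmentLength ×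
        (∀ {a} → a < t → SegmentAt (a * segmentLength) P)
    segments zero    _  = [] , [] , refl , λ ()
    segments (suc t) le
      with le' ← ≤-trans (+-monoˡ-≤ poolSize (m≤n+m (t * segmentLength) segmentLength)) le
      with P , u , lenP , at ← segments t le'
      with xs , u' , seg ← extract u (subst (λ k → k + poolSize ≤ n) (sym lenP) le')
      = P ++ xs , u' , lenP' , at'
      where
      lenP' : length (P ++ xs) ≡ suc t * segmentLength
      lenP' = trans (length-++ P) (trans (cong₂ _+_ lenP (Segment.len seg)) (+-comm (t * segmentLength) segmentLength))
      at' : ∀ {a} → a < suc t → SegmentAt (a * segmentLength) (P ++ xs)
      at' {a} a<1+t with m≤n⇒m<n∨m≡n (s≤s⁻¹ a<1+t)
      ... | inj₁ a<t = record
          { before = before ; seg = s ; after = after ++ xs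
          ; split = trans (cong (_++ xs) split) (trans (++-assoc before (s ++ after) xs) (cong (before ++_) (++-assoc s after xs)))
          ; offset = offset ; segment = segment }
        where open SegmentAt (at a<t) renaming (seg to s)
      ... | inj₂ refl = record
          { before = P ; seg = xs ; after = []
          ; split = cong (P ++_) (sym (++-identityʳ xs)) ; offset = lenP ; segment = seg }

-- Handshake lemma for cuts

bit : Bool → ℕ
bit true  = 1
bit false = 0

countTrue-map : ∀ {A : Set} (p : A → Bool) xs → countTrue (map p xs) ≡ sum (map (bit ∘ p) xs)
countTrue-map p []       = refl
countTrue-map p (x ∷ xs) with p x
... | true  = cong suc (countTrue-map p xs)
... | false = countTrue-map p xs

countTrue≤length : ∀ bs → countTrue bs ≤ length bs
countTrue≤length []           = z≤n
countTrue≤length (true ∷ bs)  = s≤s (countTrue≤length bs)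
countTrue≤length (false ∷ bs) = m≤n⇒m≤1+n (countTrue≤length bs)

countTrue-all : ∀ {A : Set} (p : A → Bool) xs → All (λ x → p x ≡ true) xs → countTrue (map p xs) ≡ length xs
countTrue-all p []       []        = refl
countTrue-all p (x ∷ xs) (px ∷ ps) rewrite px = cong suc (countTrue-all p xs ps)

countTrue-none : ∀ {A : Set} (p : A → Bool) xs → All (λ x → p x ≡ false) xs → countTrue (map p xs) ≡ 0
countTrue-none p []       []        = refl
countTrue-none p (x ∷ xs) (px ∷ ps) rewrite px = countTrue-none p xs ps

countTrue-filter : ∀ {A : Set} {Q : A → Set} (Q? : Decidable Q) (p : A → Bool) xs →
  countTrue (map (λ x → does (Q? x) ∧ p x) xs) ≡ countTrue (map p (filter Q? xs))
countTrue-filter Q? p []       = refl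
countTrue-filter Q? p (x ∷ xs) with does (Q? x)
... | false = countTrue-filter Q? p xs
... | true with p x
...   | true  = cong suc (countTrue-filter Q? p xs)
...   | false = countTrue-filter Q? p xs

countTrue-map-↭ : ∀ {A : Set} (p : A → Bool) {xs ys} → xs ↭ ys → countTrue (map p xs) ≡ countTrue (map p ys)
countTrue-map-↭ p {xs} {ys} xs↭ys = trans (countTrue-map p xs)
  (trans (sum-↭ (Perm.map⁺ (bit ∘ p) xs↭ys)) (sym (countTrue-map p ys)))

sum-map-+ : ∀ {A : Set} (f g : A → ℕ) xs → sum (map (λ x → f x + g x) xs) ≡ sum (map f xs) + sum (map g xs)
sum-map-+ f g []       = refl
sum-map-+ f g (x ∷ xs) = trans (cong (f x + g x +_) (sum-map-+ f g xs))
                               (interchange (f x) (g x) (sum (map f xs)) (sum (map g xs)))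

sum-map-const : ∀ {A : Set} (c : ℕ) (xs : List A) → sum (map (λ _ → c) xs) ≡ length xs * c
sum-map-const c []       = refl
sum-map-const c (x ∷ xs) = cong (c +_) (sum-map-const c xs)

sum-swap : ∀ {A B : Set} (f : A → B → ℕ) xs ys →
  sum (map (λ x → sum (map (f x) ys)) xs) ≡ sum (map (λ y → sum (map (λ x → f x y) xs)) ys)
sum-swap f []       ys = sym (trans (sum-map-const 0 ys) (*-zeroʳ (length ys)))
sum-swap f (x ∷ xs) ys = trans (cong (sum (map (f x) ys) +_) (sum-swap f xs ys))
  (sym (sum-map-+ (f x) (λ y → sum (map (λ x → f x y) xs)) ys))

cutDegree : ∀ {n} → Graph n → Cut n → Fin n → ℕ
cutDegree {n} G S u = countTrue (map (λ v → adj G u v ∧ (S u xor S v)) (allFin n))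

module _ {n : ℕ} (G : Graph n) (S : Cut n) where

  private
    below above : Fin n → Fin n → ℕ
    below u v = bit (adj G u v ∧ (toℕ u <ᵇ toℕ v) ∧ (S u xor S v))
    above u v = below v u

    <ᵇ-true : ∀ {i j} → i < j → (i <ᵇ j) ≡ true
    <ᵇ-true {i} {j} i<j = dec-true (i <? j) i<j

    <ᵇ-false : ∀ {i j} → ¬ i < j → (i <ᵇ j) ≡ false
    <ᵇ-false {i} {j} i≮j = dec-false (i <? j) i≮j

    -- `cutSize` counts an edge at its smaller end only: exactly one orientation passes the order
    -- test, and the diagonal vanishes by `irrefl`.
    once : ∀ u v → bit (adj G u v ∧ (S u xor S v)) ≡ below u v + above u v
    once u v rewrite Graph.sym G v u | xor-comm (S v) (S u) with <-cmp (toℕ u) (toℕ v)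
    ... | tri< u<v _ v≮u rewrite <ᵇ-true u<v | <ᵇ-false v≮u with adj G u v
    ...   | true  = sym (+-identityʳ _)
    ...   | false = refl
    once u v | tri> u≮v _ v<u rewrite <ᵇ-true v<u | <ᵇ-false u≮v with adj G u v
    ...   | true  = refl
    ...   | false = refl
    once u v | tri≈ _ eq _ rewrite F.toℕ-injective eq | irrefl G v = refl

  handshake : cutSize G S + cutSize G S ≡ sum (map (cutDegree G S) (allFin n))
  handshake = begin
    cutSize G S + cutSize G S
      ≡⟨ cong₂ _+_ size size ⟩
    Σ₂ below + Σ₂ below
      ≡⟨ cong (Σ₂ below +_) (sum-swap below (allFin n) (allFin n)) ⟩
    Σ₂ below + Σ₂ above
      ≡⟨ sum-map-+ (λ u → Σ₁ (below u)) (λ u → Σ₁ (above u)) (allFin n) ⟨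
    sum (map (λ u → Σ₁ (below u) + Σ₁ (above u)) (allFin n))
      ≡⟨ cong sum (map-cong (λ u → sym (degree-split u)) (allFin n)) ⟩
    sum (map (cutDegree G S) (allFin n)) ∎
    where
    open ≡-Reasoning
    Σ₁ : (Fin n → ℕ) → ℕ
    Σ₁ f = sum (map f (allFin n))
    Σ₂ : (Fin n → Fin n → ℕ) → ℕ
    Σ₂ f = Σ₁ (λ u → Σ₁ (f u))
    size : cutSize G S ≡ Σ₂ below
    size = cong sum (map-cong (λ u → countTrue-map _ (allFin n)) (allFin n))
    degree-split : ∀ u → cutDegree G S u ≡ Σ₁ (below u) + Σ₁ (above u)
    degree-split u = trans (countTrue-map _ (allFin n))
      (trans (cong sum (map-cong (once u) (allFin n))) (sum-map-+ (below u) (above u) (allFin n)))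

-- Graphs given by port maps

module PortGraph {n : ℕ} (ports : List (Fin n → Fin n))
  (distinct : ∀ u → Unique (map (λ f → f u) ports))
  (inverse : ∀ {f} → f ∈ ports → ∃ λ g → g ∈ ports × (∀ u → g (f u) ≡ u))
  (col : Fin n → Bool)
  (alternates : ∀ {f} → f ∈ ports → ∀ u → col (f u) ≡ not (col u)) where

  open import Data.List.Membership.DecPropositional (F._≟_ {n}) using (_∈?_)

  nbrs : Fin n → List (Fin n)
  nbrs u = map (λ f → f u) ports

  edge : Fin n → Fin n → Bool
  edge u v = does (v ∈? nbrs u)

  edge⁻ : ∀ {u v} → edge u v ≡ true → ∃ λ f → f ∈ ports × v ≡ f u
  edge⁻ {u} {v} e with v ∈? nbrs u
  ... | yes v∈ = ∈-map⁻ (λ f → f u) v∈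
  edge⁻ () | no _

  edge⁺ : ∀ {f} → f ∈ ports → ∀ u → edge u (f u) ≡ true
  edge⁺ f∈ u = dec-true (_ ∈? nbrs u) (∈-map⁺ (λ f → f u) f∈)

  edge-alternates : ∀ {u v} → edge u v ≡ true → col v ≡ not (col u)
  edge-alternates e with edge⁻ e
  ... | f , f∈ , refl = alternates f∈ _

  G : Graph n
  G = record { adj = edge ; sym = λ u v → ⇔→≡ (mk⇔ (back u v) (back v u)) ; irrefl = irr }
    where
    back : ∀ u v → edge u v ≡ true → edge v u ≡ true
    back u v e with edge⁻ e
    ... | f , f∈ , refl with inverse f∈
    ...   | g , g∈ , gf = subst (λ w → edge (f u) w ≡ true) (gf u) (edge⁺ g∈ (f u))
    irr : ∀ v → edge v v ≡ false
    irr v with edge v v in eq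
    ... | false = refl
    ... | true  = contradiction (edge-alternates eq) (not-¬ refl)

  -- Distinct ports lead to distinct neighbours, so counting over neighbours is counting over ports.
  count-nbrs : ∀ (p : Fin n → Bool) u →
    countTrue (map (λ v → edge u v ∧ p v) (allFin n)) ≡ countTrue (map p (nbrs u))
  count-nbrs p u = trans (countTrue-filter (_∈? nbrs u) p (allFin n)) (countTrue-map-↭ p
    (unique∧⇔⇒↭ (Unique.filter⁺ (_∈? nbrs u) (Unique.allFin⁺ n)) (distinct u)
      (λ z∈ → proj₂ (∈-filter⁻ (_∈? nbrs u) {xs = allFin n} z∈))
      (λ {z} z∈ → ∈-filter⁺ (_∈? nbrs u) (∈-allFin z) z∈)))

  regular : Regular (length ports) G
  regular u = begin
    countTrue (map (edge u) (allFin n))                 ≡⟨ cong countTrue (map-cong (λ v → sym (∧-identityʳ (edge u v))) (allFin n)) ⟩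
    countTrue (map (λ v → edge u v ∧ true) (allFin n))  ≡⟨ count-nbrs (λ _ → true) u ⟩
    countTrue (map (λ _ → true) (nbrs u))               ≡⟨ countTrue-all (λ _ → true) (nbrs u) (All.universal (λ _ → refl) (nbrs u)) ⟩
    length (nbrs u)                                     ≡⟨ length-map (λ f → f u) ports ⟩
    length ports                                        ∎
    where open ≡-Reasoning

  bipartite : Bipartite G
  bipartite = col , λ u v e eq → not-¬ eq (trans (sym (not-involutive (col u))) (cong not (sym (edge-alternates e))))

  inClass : InClass (length ports) G
  inClass = bipartite , regular

  cutDegree-nbrs : ∀ S u → cutDegree G S u ≡ countTrue (map (λ v → S u xor S v) (nbrs u))
  cutDegree-nbrs S u = count-nbrs (λ v → S u xor S v) u

  cutDegree≤ : ∀ S u → cutDegree G S u ≤ length ports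
  cutDegree≤ S u = begin
    cutDegree G S u                             ≡⟨ cutDegree-nbrs S u ⟩
    countTrue (map (λ v → S u xor S v) (nbrs u)) ≤⟨ countTrue≤length (map (λ v → S u xor S v) (nbrs u)) ⟩
    length (map (λ v → S u xor S v) (nbrs u))    ≡⟨ trans (length-map _ (nbrs u)) (length-map _ ports) ⟩
    length ports                                 ∎
    where open ≤-Reasoning

  cutDegree-col : ∀ u → cutDegree G col u ≡ length ports
  cutDegree-col u = trans (cutDegree-nbrs col u)
    (trans (countTrue-all _ (nbrs u) (All.tabulate crosses)) (length-map _ ports))
    where
    crosses : ∀ {v} → v ∈ nbrs u → col u xor col v ≡ true
    crosses v∈ with ∈-map⁻ (λ f → f u) v∈
    ... | f , f∈ , refl rewrite alternates f∈ u = xor-inverseʳ (col u)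

  2cut-col : cutSize G col + cutSize G col ≡ n * length ports
  2cut-col = begin
    cutSize G col + cutSize G col                 ≡⟨ handshake G col ⟩
    sum (map (cutDegree G col) (allFin n))        ≡⟨ cong sum (map-cong cutDegree-col (allFin n)) ⟩
    sum (map (λ _ → length ports) (allFin n))     ≡⟨ sum-map-const (length ports) (allFin n) ⟩
    length (allFin n) * length ports              ≡⟨ cong (_* length ports) (length-tabulate {n = n} id) ⟩
    n * length ports                              ∎
    where open ≡-Reasoning

  -- The head of the list is the last step, as in `Within`, which extends a path at its far end.
  walk : List (Fin n → Fin n) → Fin n → Fin n
  walk []       u = u
  walk (f ∷ fs) u = f (walk fs u)

  within⇒walk : ∀ k {v u} → Within G k v u →
    ∃ λ fs → All (_∈ ports) fs × length fs ≤ k × u ≡ walk fs v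
  within⇒walk zero    refl     = [] , [] , z≤n , refl
  within⇒walk (suc k) (inj₁ w) with within⇒walk k w
  ... | fs , fs∈ , le , eq = fs , fs∈ , m≤n⇒m≤1+n le , eq
  within⇒walk (suc k) (inj₂ (w , vw , wu)) with within⇒walk k vw | edge⁻ wu
  ... | fs , fs∈ , le , refl | f , f∈ , refl = f ∷ fs , f∈ ∷ fs∈ , s≤s le , refl

  walk⇒within : ∀ {k} fs → All (_∈ ports) fs → length fs ≤ k → ∀ v → Within G k v (walk fs v)
  walk⇒within {zero}  []       _          _        v = refl
  walk⇒within {suc k} []       _          _        v = inj₁ (walk⇒within {k} [] [] z≤n v)
  walk⇒within         (f ∷ fs) (f∈ ∷ fs∈) (s≤s le) v =
    inj₂ (walk fs v , walk⇒within fs fs∈ le v , edge⁺ f∈ (walk fs v))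

  near⇒walk : ∀ r {v u} → Near G r v u →
    ∃ λ fs → All (_∈ ports) fs × suc (length fs) ≤ r × u ≡ walk fs v
  near⇒walk (suc r) w with within⇒walk r w
  ... | fs , fs∈ , le , eq = fs , fs∈ , s≤s le , eq

  -- Port words serve as common coordinates for two balls, so views are compared without building an
  -- isomorphism between them.
  SameLabels : ∀ {c} → ℕ → IdAssignment n c → Fin n → IdAssignment n c → Fin n → Set
  SameLabels r ι v ι' v' = ∀ fs → All (_∈ ports) fs → length fs ≤ r →
    ident ι (walk fs v) ≡ ident ι' (walk fs v')

  module _ {c r : ℕ} {ι ι' : IdAssignment n c} {v v' : Fin n} where

    -- An edge at a vertex at distance below `r` is the last step of a walk of length at most `r`.
    -- The identifiers agree at both of its ends, and injectivity of `ι'` recovers `u'` and `w'`.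
    sameLabels-adj : SameLabels r ι v ι' v' → ∀ {u w u' w'} → ident ι u ≡ ident ι' u' →
      ident ι w ≡ ident ι' w' → Near G r v u → edge u w ≡ true → edge u' w' ≡ true
    sameLabels-adj same eu ew near e with near⇒walk r near | edge⁻ e
    ... | fs , fs∈ , lt , refl | f , f∈ , refl =
      subst₂ (λ a b → edge a b ≡ true)
        (inj ι' (trans (sym (same fs fs∈ (≤-trans (n≤1+n _) lt))) eu))
        (inj ι' (trans (sym (same (f ∷ fs) (f∈ ∷ fs∈) lt)) ew))
        (edge⁺ f∈ (walk fs v'))

    sameLabels-near : SameLabels r ι v ι' v' → ∀ {u u'} → ident ι u ≡ ident ι' u' →
      Near G r v u → Near G r v' u'
    sameLabels-near same eu near with near⇒walk r near
    ... | fs , fs∈ , lt , refl = go lt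
      where
      go : ∀ {r} → suc (length fs) ≤ r → Near G r v' _
      go (s≤s le) = subst (Within G _ v') (inj ι' (trans (sym (same fs fs∈ (≤-trans (n≤1+n _) lt))) eu))
        (walk⇒within fs fs∈ le v')

    sameLabels-within : SameLabels r ι v ι' v' → ∀ u → Within G r v u →
      ∃ λ u' → ident ι' u' ≡ ident ι u × Within G r v' u'
    sameLabels-within same u w with within⇒walk r w
    ... | fs , fs∈ , le , refl = walk fs v' , sym (same fs fs∈ le) , walk⇒within fs fs∈ le v'

  sameView : ∀ {c r} {ι ι' : IdAssignment n c} {v v'} → SameLabels r ι v ι' v' → SameView r G ι v G ι' v'
  sameView {r = r} {ι} {ι'} {v} {v'} same =
    same [] [] z≤n ,
    sameLabels-within {ι = ι} {ι'} same ,
    sameLabels-within {ι = ι'} {ι} same' ,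
    λ u w u' w' eu ew near → ⇔→≡ (mk⇔
      (sameLabels-adj {ι = ι} {ι'} same eu ew (nearˡ eu near))
      (sameLabels-adj {ι = ι'} {ι} same' (sym eu) (sym ew) (nearʳ eu near)))
    where
    same' : SameLabels r ι' v' ι v
    same' fs fs∈ le = sym (same fs fs∈ le)
    nearˡ : ∀ {u u'} → ident ι u ≡ ident ι' u' → Near G r v u ⊎ Near G r v' u' → Near G r v u
    nearˡ eu (inj₁ p) = p
    nearˡ eu (inj₂ p) = sameLabels-near {ι = ι'} {ι} same' (sym eu) p
    nearʳ : ∀ {u u'} → ident ι u ≡ ident ι' u' → Near G r v u ⊎ Near G r v' u' → Near G r v' u'
    nearʳ eu (inj₁ p) = sameLabels-near {ι = ι} {ι'} same eu p
    nearʳ eu (inj₂ p) = p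

-- Iteration of maps and parity

bitFin : Bool → Fin 2
bitFin false = zero
bitFin true  = suc zero

times : {A : Set} → (A → A) → ℕ → A → A
times f zero    x = x
times f (suc k) x = f (times f k x)

module _ {A : Set} where

  times-+ : ∀ (f : A → A) j k x → times f (j + k) x ≡ times f j (times f k x)
  times-+ f zero    k x = refl
  times-+ f (suc j) k x = cong f (times-+ f j k x)

  times-comm : ∀ (f g : A → A) → (∀ x → f (g x) ≡ g (f x)) → ∀ k x → times f k (g x) ≡ g (times f k x)
  times-comm f g fg zero    x = refl
  times-comm f g fg (suc k) x = trans (cong f (times-comm f g fg k x)) (fg _)

  times-inverse : ∀ (f g : A → A) → (∀ x → g (f x) ≡ x) → ∀ k x → times g k (times f k x) ≡ x
  times-inverse f g gf zero    x = refl
  times-inverse f g gf (suc k) x = trans (sym (times-comm g g (λ _ → refl) k _))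
    (trans (cong (times g k) (gf _)) (times-inverse f g gf k x))

odd : ℕ → Bool
odd zero    = false
odd (suc n) = not (odd n)

odd-double : ∀ n → odd (n + n) ≡ false
odd-double zero    = refl
odd-double (suc n) = trans (cong (not ∘ odd) (+-suc n n)) (trans (not-involutive _) (odd-double n))

-- The twisted ladder
module Ladder (h' : ℕ) where

  h : ℕ
  h = suc h'

  Vertex : Set
  Vertex = Fin (h * 2)

  code : Fin h → Bool → Vertex
  code i b = combine i (bitFin b)

  pos : Vertex → Fin h
  pos u = proj₁ (remQuot {h} 2 u)

  isOne : Fin 2 → Bool
  isOne zero       = false
  isOne (suc zero) = true

  side : Vertex → Bool
  side u = isOne (proj₂ (remQuot {h} 2 u))

  pos-code : ∀ i b → pos (code i b) ≡ i
  pos-code i b = cong proj₁ (F.remQuot-combine {h} {2} i _)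

  side-code : ∀ i b → side (code i b) ≡ b
  side-code i b = trans (cong (isOne ∘ proj₂) (F.remQuot-combine {h} {2} i _)) (lemma b)
    where
    lemma : ∀ b → isOne (bitFin b) ≡ b
    lemma true  = refl
    lemma false = refl

  code-pos-side : ∀ u → code (pos u) (side u) ≡ u
  code-pos-side u = trans (cong (combine (pos u)) (lemma _)) (F.combine-remQuot {h} 2 u)
    where
    lemma : ∀ j → bitFin (isOne j) ≡ j
    lemma zero       = refl
    lemma (suc zero) = refl

  code-injective : ∀ {i b j b'} → code i b ≡ code j b' → i ≡ j × b ≡ b'
  code-injective {i} {b} {j} {b'} eq =
    trans (sym (pos-code i b)) (trans (cong pos eq) (pos-code j b')) ,
    trans (sym (side-code i b)) (trans (cong side eq) (side-code j b'))

  -- The side is exchanged when going around an odd ladder, which keeps it bipartite.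
  twist : Bool → Bool
  twist b = b xor odd h

  twist-involutive : ∀ b → twist (twist b) ≡ b
  twist-involutive b = trans (xor-assoc b (odd h) (odd h))
    (trans (cong (b xor_) (xor-same (odd h))) (xor-identityʳ b))

  next : Fin h → Bool → Vertex
  next i b with toℕ i <? h'
  ... | yes i<h' = code (suc (fromℕ< i<h')) b
  ... | no _     = code zero (twist b)

  prev : Fin h → Bool → Vertex
  prev zero    b = code (fromℕ h') (twist b)
  prev (suc j) b = code (inject₁ j) b

  right left flip : Vertex → Vertex
  right u = next (pos u) (side u)
  left  u = prev (pos u) (side u)
  flip  u = code (pos u) (not (side u))

  right-code : ∀ i b → right (code i b) ≡ next i b
  right-code i b = cong₂ next (pos-code i b) (side-code i b)

  left-code : ∀ i b → left (code i b) ≡ prev i b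
  left-code i b = cong₂ prev (pos-code i b) (side-code i b)

  flip-code : ∀ i b → flip (code i b) ≡ code i (not b)
  flip-code i b = cong₂ (λ i b → code i (not b)) (pos-code i b) (side-code i b)

  last≡ : ∀ {i : Fin h} → ¬ toℕ i < h' → toℕ i ≡ h'
  last≡ {i} i≮h' = ≤-antisym (F.toℕ≤pred[n] i) (≮⇒≥ i≮h')

  left-right : ∀ u → left (right u) ≡ u
  left-right u = trans (lemma (pos u) (side u)) (code-pos-side u)
    where
    lemma : ∀ i b → left (next i b) ≡ code i b
    lemma i b with toℕ i <? h'
    ... | yes i<h' = trans (left-code (suc (fromℕ< i<h')) b) (cong (λ j → code j b) (F.toℕ-injective
            (trans (F.toℕ-inject₁ _) (F.toℕ-fromℕ< i<h'))))
    ... | no i≮h' = trans (left-code zero (twist b)) (cong₂ code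
            (F.toℕ-injective (trans (F.toℕ-fromℕ h') (sym (last≡ i≮h')))) (twist-involutive b))

  right-left : ∀ u → right (left u) ≡ u
  right-left u = trans (lemma (pos u) (side u)) (code-pos-side u)
    where
    lemma : ∀ i b → right (prev i b) ≡ code i b
    lemma zero b = trans (right-code (fromℕ h') (twist b)) wrap
      where
      wrap : next (fromℕ h') (twist b) ≡ code zero b
      wrap with toℕ (fromℕ h') <? h'
      ... | yes lt = contradiction lt (<-irrefl (F.toℕ-fromℕ h'))
      ... | no _   = cong (code zero) (twist-involutive b)
    lemma (suc j) b = trans (right-code (inject₁ j) b) step
      where
      step : next (inject₁ j) b ≡ code (suc j) b
      step with toℕ (inject₁ j) <? h'
      ... | yes lt = cong (λ i → code (suc i) b) (F.toℕ-injective (trans (F.toℕ-fromℕ< lt) (F.toℕ-inject₁ j)))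
      ... | no ¬lt = contradiction (subst (_< h') (sym (F.toℕ-inject₁ j)) (F.toℕ<n j)) ¬lt

  flip-flip : ∀ u → flip (flip u) ≡ u
  flip-flip u = trans (flip-code (pos u) (not (side u)))
    (trans (cong (code (pos u)) (not-involutive (side u))) (code-pos-side u))

  pos-flip : ∀ u → pos (flip u) ≡ pos u
  pos-flip u = pos-code (pos u) (not (side u))

  -- The twist is an xor with a constant and so commutes with exchanging the sides, even across the
  -- seam.
  right-flip : ∀ u → right (flip u) ≡ flip (right u)
  right-flip u = trans (right-code (pos u) (not (side u))) (lemma (pos u) (side u))
    where
    lemma : ∀ i b → next i (not b) ≡ flip (next i b)
    lemma i b with toℕ i <? h'
    ... | yes i<h' = sym (flip-code (suc (fromℕ< i<h')) b)
    ... | no _     = sym (trans (flip-code zero (twist b)) (cong (code zero) (not-distribˡ-xor b (odd h))))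

  colour : Vertex → Bool
  colour u = odd (toℕ (pos u)) xor side u

  colour-code : ∀ i b → colour (code i b) ≡ odd (toℕ i) xor b
  colour-code i b = cong₂ (λ i b → odd (toℕ i) xor b) (pos-code i b) (side-code i b)

  colour-flip : ∀ u → colour (flip u) ≡ not (colour u)
  colour-flip u = trans (colour-code (pos u) (not (side u))) (sym (not-distribʳ-xor (odd (toℕ (pos u))) (side u)))

  -- At the seam the parity of the position jumps from `odd h'` to `false`; the twist by `odd h`,
  -- which is `not (odd h')`, restores the alternation.
  colour-right : ∀ u → colour (right u) ≡ not (colour u)
  colour-right u = lemma (pos u) (side u)
    where
    bool : ∀ x b → b xor not x ≡ not (x xor b)
    bool true  true  = refl
    bool true  false = refl
    bool false true  = refl
    bool false false = refl
    lemma : ∀ i b → colour (next i b) ≡ not (odd (toℕ i) xor b)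
    lemma i b with toℕ i <? h'
    ... | yes i<h' = trans (colour-code (suc (fromℕ< i<h')) b)
            (trans (cong (λ k → not (odd k) xor b) (F.toℕ-fromℕ< i<h')) (sym (not-distribˡ-xor (odd (toℕ i)) b)))
    ... | no i≮h' = trans (colour-code zero (twist b))
            (trans (bool (odd h') b) (cong (λ k → not (odd k xor b)) (sym (last≡ i≮h'))))

  colour-left : ∀ u → colour (left u) ≡ not (colour u)
  colour-left u = trans (sym (not-involutive _)) (cong not
    (trans (sym (colour-right (left u))) (cong colour (right-left u))))

  up down : ℕ → Vertex → Vertex
  up   = times right
  down = times left

  down-up : ∀ k u → down k (up k u) ≡ u
  down-up = times-inverse right left left-right

  up-down : ∀ k u → up k (down k u) ≡ u
  up-down = times-inverse left right right-left

  colour-times : ∀ (f : Vertex → Vertex) → (∀ u → colour (f u) ≡ not (colour u)) →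
    ∀ k u → colour (times f k u) ≡ odd k xor colour u
  colour-times f fc zero    u = refl
  colour-times f fc (suc k) u = trans (fc _) (trans (cong not (colour-times f fc k u)) (not-distribˡ-xor (odd k) (colour u)))

  -- Position x may exceed h: V is a covering of the ladder by two rays.
  V : ℕ → Bool → Vertex
  V x b = up x (code zero b)

  V-+ : ∀ k x b → V (k + x) b ≡ up k (V x b)
  V-+ k x b = times-+ right k x (code zero b)

  down-V : ∀ k x b → down k (V (k + x) b) ≡ V x b
  down-V k x b = trans (cong (down k) (V-+ k x b)) (down-up k (V x b))

  flip-V : ∀ x b → flip (V x b) ≡ V x (not b)
  flip-V x b = trans (sym (times-comm right flip right-flip x (code zero b))) (cong (up x) (flip-code zero b))

  V-code : ∀ {x} (x<h : x < h) b → V x b ≡ code (fromℕ< x<h) b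
  V-code {zero}  x<h b = refl
  V-code {suc x} x<h b = trans (cong right (V-code (<-trans (n<1+n x) x<h) b)) (trans (right-code _ b) step)
    where
    step : next (fromℕ< (<-trans (n<1+n x) x<h)) b ≡ code (fromℕ< x<h) b
    step with toℕ (fromℕ< (<-trans (n<1+n x) x<h)) <? h'
    ... | yes lt = cong (λ j → code j b) (F.toℕ-injective (trans (cong suc (trans (F.toℕ-fromℕ< lt)
            (F.toℕ-fromℕ< (<-trans (n<1+n x) x<h)))) (sym (F.toℕ-fromℕ< x<h))))
    ... | no ¬lt = contradiction (subst (_< h') (sym (F.toℕ-fromℕ< (<-trans (n<1+n x) x<h))) (s<s⁻¹ x<h)) ¬lt

  pos-V : ∀ {x} → x < h → ∀ b → toℕ (pos (V x b)) ≡ x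
  pos-V x<h b = trans (cong (toℕ ∘ pos) (V-code x<h b)) (trans (cong toℕ (pos-code _ b)) (F.toℕ-fromℕ< x<h))

  side-V : ∀ {x} → x < h → ∀ b → side (V x b) ≡ b
  side-V x<h b = trans (cong side (V-code x<h b)) (side-code (fromℕ< x<h) b)

  V-pos-side : ∀ u → V (toℕ (pos u)) (side u) ≡ u
  V-pos-side u = trans (V-code (F.toℕ<n (pos u)) (side u))
    (trans (cong (λ i → code i (side u)) (F.fromℕ<-toℕ (pos u) _)) (code-pos-side u))

  V-wrap : ∀ x b → V (x + h) b ≡ V x (twist b)
  V-wrap x b = trans (V-+ x h b) (cong (up x) wrap)
    where
    wrap : right (V h' b) ≡ code zero (twist b)
    wrap = trans (cong right (V-code (n<1+n h') b)) (trans (right-code _ b) end)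
      where
      end : next (fromℕ< (n<1+n h')) b ≡ code zero (twist b)
      end with toℕ (fromℕ< (n<1+n h')) <? h'
      ... | yes lt = contradiction lt (<-irrefl (F.toℕ-fromℕ< (n<1+n h')))
      ... | no _   = refl

  -- From position `x` the shift arrives at `t + x`, or at `t + x ∸ h` after one wrap; these equal
  -- `x` only for `t = 0` and `t = h`. Speaking of rungs rather than vertices also covers the twist
  -- and separates shifts from `flip`.
  up-moves : ∀ {t} → 0 < t → t < h → ∀ u → pos (up t u) ≢ pos u
  up-moves {t} 0<t t<h u eq with t + toℕ (pos u) <? h
  ... | yes lt = contradiction 0<t (≤⇒≯ (+-cancelʳ-≤ x t 0 (≤-reflexive
          (trans (sym (pos-V lt (side u))) (trans (cong (toℕ ∘ pos) V≡) (cong toℕ eq))))))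
    where
    x = toℕ (pos u)
    V≡ : V (t + x) (side u) ≡ up t u
    V≡ = trans (V-+ t x (side u)) (cong (up t) (V-pos-side u))
  ... | no ¬lt = contradiction t<h (≤⇒≯ (≤-reflexive (sym (+-cancelʳ-≡ x t h
          (trans (sym y+h) (trans (cong (_+ h) y≡x) (+-comm x h)))))))
    where
    x = toℕ (pos u)
    y = t + x ∸ h
    y+h : y + h ≡ t + x
    y+h = m∸n+n≡m (≮⇒≥ ¬lt)
    y<h : y < h
    y<h = +-cancelʳ-< h y h (subst (_< h + h) (sym y+h) (+-mono-< t<h (F.toℕ<n (pos u))))
    V≡ : V y (twist (side u)) ≡ up t u
    V≡ = trans (sym (V-wrap y (side u))) (trans (cong (λ k → V k (side u)) y+h)
           (trans (V-+ t x (side u)) (cong (up t) (V-pos-side u))))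
    y≡x : y ≡ x
    y≡x = trans (sym (pos-V y<h (twist (side u)))) (trans (cong (toℕ ∘ pos) V≡) (cong toℕ eq))

  shifts : ℕ → List (Vertex → Vertex)
  shifts zero    = []
  shifts (suc j) = up (suc (j + j)) ∷ down (suc (j + j)) ∷ shifts j

  ∈-shifts⁻ : ∀ {e f} → f ∈ shifts e → ∃ λ j → j < e × (f ≡ up (suc (j + j)) ⊎ f ≡ down (suc (j + j)))
  ∈-shifts⁻ {suc e} (here eq)         = e , n<1+n e , inj₁ eq
  ∈-shifts⁻ {suc e} (there (here eq)) = e , n<1+n e , inj₂ eq
  ∈-shifts⁻ {suc e} (there (there m)) with ∈-shifts⁻ m
  ... | j , j<e , eq = j , m<n⇒m<1+n j<e , eq

  up∈shifts : ∀ {e j} → j < e → up (suc (j + j)) ∈ shifts e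
  up∈shifts {suc e} j<1+e with m≤n⇒m<n∨m≡n (s≤s⁻¹ j<1+e)
  ... | inj₁ j<e  = there (there (up∈shifts j<e))
  ... | inj₂ refl = here refl

  down∈shifts : ∀ {e j} → j < e → down (suc (j + j)) ∈ shifts e
  down∈shifts {suc e} j<1+e with m≤n⇒m<n∨m≡n (s≤s⁻¹ j<1+e)
  ... | inj₁ j<e  = there (there (down∈shifts j<e))
  ... | inj₂ refl = there (here refl)

  length-shifts : ∀ e → length (shifts e) ≡ e + e
  length-shifts zero    = refl
  length-shifts (suc e) = cong suc (trans (cong suc (length-shifts e)) (sym (+-suc e e)))

  step≤ : ∀ {j e} → j < e → suc (j + j) < e + e
  step≤ {j} {e} j<e = subst (_≤ e + e) (cong suc (+-suc j j)) (+-mono-≤ j<e j<e)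

  up-up-apart : ∀ {j k} → j < k → k < h → ∀ u → pos (up k u) ≢ pos (up j u)
  up-up-apart {j} {k} j<k k<h u eq = up-moves (m<n⇒0<n∸m j<k) (≤-<-trans (m∸n≤m k j) k<h) (up j u)
    (trans (cong pos (trans (sym (times-+ right (k ∸ j) j u)) (cong (λ i → up i u) (m∸n+n≡m (<⇒≤ j<k))))) eq)

  up-down-apart : ∀ {j k} → 0 < k + j → k + j < h → ∀ u → pos (up k u) ≢ pos (down j u)
  up-down-apart {j} {k} 0< <h u eq = up-moves 0< <h (down j u)
    (trans (cong pos (trans (times-+ right k j (down j u)) (cong (up k) (up-down j u)))) eq)

  down-down-apart : ∀ {j k} → j < k → k < h → ∀ u → pos (down j u) ≢ pos (down k u)
  down-down-apart {j} {k} j<k k<h u = subst (λ w → pos (down j w) ≢ pos (down k w)) (up-down k u)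
    (subst₂ (λ a b → pos a ≢ pos b) (sym lem) (sym (down-up k v)) (up-moves (m<n⇒0<n∸m j<k) (≤-<-trans (m∸n≤m k j) k<h) v))
    where
    v = down k u
    lem : down j (up k v) ≡ up (k ∸ j) v
    lem = trans (cong (λ i → down j (up i v)) (sym (m+[n∸m]≡n (<⇒≤ j<k))))
      (trans (cong (down j) (times-+ right j (k ∸ j) v)) (down-up j _))

  ≢-of-pos : ∀ {u v : Vertex} → pos u ≢ pos v → u ≢ v
  ≢-of-pos ne refl = ne refl

  -- Two of the shifts differ by at most `4e - 2` positions, less than a full turn when `4e ≤ h`.
  shifts-distinct : ∀ e → (e + e) + (e + e) ≤ h → ∀ u → Unique (map (λ f → f u) (shifts e))
  shifts-distinct zero    _  u = []
  shifts-distinct (suc e) le u =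
    (≢-of-pos (up-down-apart {k} {k} z<s k+k<h u) ∷ All.map⁺ (All.tabulate up≢)) ∷
    All.map⁺ (All.tabulate down≢) ∷
    shifts-distinct e (≤-trans (+-mono-≤ e≤ e≤) le) u
    where
    k = suc (e + e)
    k<2e : k < suc e + suc e
    k<2e = step≤ (n<1+n e)
    e≤ : e + e ≤ suc e + suc e
    e≤ = +-mono-≤ (n≤1+n e) (n≤1+n e)
    k+k<h : k + k < h
    k+k<h = <-≤-trans (+-mono-< k<2e k<2e) le
    k<h : k < h
    k<h = ≤-<-trans (m≤m+n k k) k+k<h
    up≢ : ∀ {f} → f ∈ shifts e → up k u ≢ f u
    up≢ f∈ with ∈-shifts⁻ f∈
    ... | j , j<e , inj₁ refl = ≢-of-pos (up-up-apart (m<n⇒m<1+n (step≤ j<e)) k<h u)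
    ... | j , j<e , inj₂ refl = ≢-of-pos (up-down-apart {suc (j + j)} {k} z<s
            (≤-<-trans (+-monoʳ-≤ k (<⇒≤ (m<n⇒m<1+n (step≤ j<e)))) k+k<h) u)
    down≢ : ∀ {f} → f ∈ shifts e → down k u ≢ f u
    down≢ f∈ with ∈-shifts⁻ f∈
    ... | j , j<e , inj₁ refl = ≢-sym (≢-of-pos (up-down-apart {k} {suc (j + j)} z<s
            (≤-<-trans (+-monoˡ-≤ k (<⇒≤ (m<n⇒m<1+n (step≤ j<e)))) k+k<h) u))
    ... | j , j<e , inj₂ refl = ≢-sym (≢-of-pos (down-down-apart (m<n⇒m<1+n (step≤ j<e)) k<h u))

  shift-moves : ∀ {e} → (e + e) + (e + e) ≤ h → ∀ {f} → f ∈ shifts e → ∀ u → pos (f u) ≢ pos u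
  shift-moves {e} le f∈ u with ∈-shifts⁻ f∈
  ... | j , j<e , inj₁ refl = up-moves z<s (<-≤-trans (step≤ j<e) (≤-trans (m≤m+n (e + e) _) le)) u
  ... | j , j<e , inj₂ refl = ≢-sym (up-down-apart {suc (j + j)} {0} z<s
          (<-≤-trans (step≤ j<e) (≤-trans (m≤m+n (e + e) _) le)) u)

-- The regular bipartite graph on the ladder

module LadderGraph (h' e : ℕ) (δ : Bool) (wide : (e + e) + (e + e) ≤ suc h') where

  open Ladder h'

  rungs : Bool → List (Vertex → Vertex)
  rungs true  = flip ∷ []
  rungs false = []

  ports : List (Vertex → Vertex)
  ports = rungs δ ++ shifts e

  data IsPort (f : Vertex → Vertex) : Set where
    isFlip : δ ≡ true → f ≡ flip → IsPort f
    isUp   : ∀ {j} → j < e → f ≡ up (suc (j + j)) → IsPort f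
    isDown : ∀ {j} → j < e → f ≡ down (suc (j + j)) → IsPort f

  ∈-rungs⁻ : ∀ {b f} → f ∈ rungs b → b ≡ true × f ≡ flip
  ∈-rungs⁻ {true} (here eq) = refl , eq

  isPort : ∀ {f} → f ∈ ports → IsPort f
  isPort f∈ with ∈-++⁻ (rungs δ) f∈
  ... | inj₁ f∈r = isFlip (proj₁ (∈-rungs⁻ f∈r)) (proj₂ (∈-rungs⁻ f∈r))
  ... | inj₂ f∈s with ∈-shifts⁻ f∈s
  ...   | j , j<e , inj₁ eq = isUp j<e eq
  ...   | j , j<e , inj₂ eq = isDown j<e eq

  shift∈ports : ∀ {f} → f ∈ shifts e → f ∈ ports
  shift∈ports = ∈-++⁺ʳ (rungs δ)

  flip∈ports : δ ≡ true → flip ∈ ports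
  flip∈ports on = ∈-++⁺ˡ (subst (λ b → flip ∈ rungs b) (sym on) (here refl))

  distinct : ∀ u → Unique (map (λ f → f u) ports)
  distinct u = lemma δ
    where
    lemma : ∀ b → Unique (map (λ f → f u) (rungs b ++ shifts e))
    lemma false = shifts-distinct e wide u
    lemma true  = All.map⁺ (All.tabulate (λ f∈ → ≢-sym (≢-of-pos (λ eq →
                    shift-moves wide f∈ u (trans eq (pos-flip u)))))) ∷ shifts-distinct e wide u

  inverse : ∀ {f} → f ∈ ports → ∃ λ g → g ∈ ports × (∀ u → g (f u) ≡ u)
  inverse f∈ with isPort f∈
  ... | isFlip on refl    = flip , flip∈ports on , flip-flip
  ... | isUp {j} j<e refl   = down (suc (j + j)) , shift∈ports (down∈shifts j<e) , down-up (suc (j + j))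
  ... | isDown {j} j<e refl = up (suc (j + j)) , shift∈ports (up∈shifts j<e) , up-down (suc (j + j))

  alternates : ∀ {f} → f ∈ ports → ∀ u → colour (f u) ≡ not (colour u)
  alternates f∈ u with isPort f∈
  ... | isFlip on refl      = colour-flip u
  ... | isUp {j} j<e refl   = trans (colour-times right colour-right (suc (j + j)) u)
                                (cong (λ b → not b xor colour u) (odd-double j))
  ... | isDown {j} j<e refl = trans (colour-times left colour-left (suc (j + j)) u)
                                (cong (λ b → not b xor colour u) (odd-double j))

  open PortGraph ports distinct inverse colour alternates public

  length-ports : length ports ≡ bit δ + (e + e)
  length-ports = trans (length-++ (rungs δ)) (cong₂ _+_ (length-rungs δ) (length-shifts e))
    where
    length-rungs : ∀ b → length (rungs b) ≡ bit b
    length-rungs true  = refl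
    length-rungs false = refl

  tracks : List Vertex
  tracks = applyUpTo (λ x → V x false) h ++ applyUpTo (λ x → V x true) h

  tracks-↭ : allFin (h * 2) ↭ tracks
  tracks-↭ = unique∧⇔⇒↭ (Unique.allFin⁺ (h * 2)) (Unique.++⁺ (track false) (track true) disjoint)
    (λ {u} _ → member u) (λ {u} _ → ∈-allFin u)
    where
    track : ∀ b → Unique (applyUpTo (λ x → V x b) h)
    track b = Unique.applyUpTo⁺₁ (λ x → V x b) h λ i<j j<h eq → <⇒≢ i<j
      (trans (sym (pos-V (<-trans i<j j<h) b)) (trans (cong (toℕ ∘ pos) eq) (pos-V j<h b)))
    disjoint : ∀ {u} → ¬ (u ∈ applyUpTo (λ x → V x false) h × u ∈ applyUpTo (λ x → V x true) h)
    disjoint (p , q) with ∈-applyUpTo⁻ (λ x → V x false) p | ∈-applyUpTo⁻ (λ x → V x true) q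
    ... | i , i<h , eq | j , j<h , eq'
      with () ← trans (sym (side-V i<h false)) (trans (cong side (trans (sym eq) eq')) (side-V j<h true))
    member : ∀ u → u ∈ tracks
    member u = subst (_∈ tracks) (V-pos-side u) (V∈ (side u))
      where
      V∈ : ∀ b → V (toℕ (pos u)) b ∈ tracks
      V∈ false = ∈-++⁺ˡ (∈-applyUpTo⁺ (λ x → V x false) (F.toℕ<n (pos u)))
      V∈ true  = ∈-++⁺ʳ (applyUpTo (λ x → V x false) h) (∈-applyUpTo⁺ (λ x → V x true) (F.toℕ<n (pos u)))

  sum-tracks : ∀ (f : Vertex → ℕ) → sum (map f (allFin (h * 2))) ≡
    sum (applyUpTo (λ x → f (V x false)) h) + sum (applyUpTo (λ x → f (V x true)) h)
  sum-tracks f = begin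
    sum (map f (allFin (h * 2)))  ≡⟨ sum-↭ (Perm.map⁺ f tracks-↭) ⟩
    sum (map f tracks)            ≡⟨ cong sum (map-++ f (applyUpTo (λ x → V x false) h) _) ⟩
    sum (map f (applyUpTo (λ x → V x false) h) ++ map f (applyUpTo (λ x → V x true) h))
      ≡⟨ sum-++ (map f (applyUpTo (λ x → V x false) h)) _ ⟩
    sum (map f (applyUpTo (λ x → V x false) h)) + sum (map f (applyUpTo (λ x → V x true) h))
      ≡⟨ cong₂ (λ xs ys → sum xs + sum ys) (map-applyUpTo (λ x → V x false) f h) (map-applyUpTo (λ x → V x true) f h) ⟩
    sum (applyUpTo (λ x → f (V x false)) h) + sum (applyUpTo (λ x → f (V x true)) h) ∎
    where open ≡-Reasoning

  cutDegree-shifts : ∀ S u → (∀ {f} → f ∈ shifts e → S (f u) ≡ S u) → cutDegree G S u ≤ bit δ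
  cutDegree-shifts S u same = ≤-trans (≤-reflexive (cutDegree-nbrs S u)) (lemma δ)
    where
    uncut : countTrue (map (λ v → S u xor S v) (map (λ f → f u) (shifts e))) ≡ 0
    uncut = countTrue-none (λ v → S u xor S v) _ (All.map⁺ (All.tabulate
      (λ f∈ → trans (cong (S u xor_) (same f∈)) (xor-same (S u)))))
    lemma : ∀ b → countTrue (map (λ v → S u xor S v) (map (λ f → f u) (rungs b ++ shifts e))) ≤ bit b
    lemma false = ≤-reflexive uncut
    lemma true with S u xor S (flip u)
    ... | true  = s≤s (≤-reflexive uncut)
    ... | false = ≤-trans (≤-reflexive uncut) z≤n

  -- Identifiers come in consecutive pairs; the pair of the rung at x is listed at index x.
  module _ (c : ℕ) (1≤c : 1 ≤ c) where

    label : List (Fin h) → Vertex → ℕ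
    label L u = suc (toℕ (code (nth zero L (toℕ (pos u))) (side u)))

    labelling : (P : List (Fin h)) → Unique P → IdAssignment (h * 2) c
    labelling P uP = record
      { ident = label (complete P)
      ; inj   = λ {u} {v} eq → injective eq
      ; lower = λ _ → s≤s z≤n
      -- The identifiers used are at most `h * 2`, the number of vertices, which is within its power
      -- `c` because `1 ≤ c`.
      ; upper = λ u → ≤-trans (F.toℕ<n (code (nth zero (complete P) (toℕ (pos u))) (side u)))
                  (subst (_≤ (h * 2) ^ c) (^-identityʳ (h * 2)) (^-monoʳ-≤ (h * 2) 1≤c)) }
      where
      in-range : ∀ (i : Fin h) → toℕ i < length (complete P)
      in-range i = subst (toℕ i <_) (sym (length-complete uP)) (F.toℕ<n i)
      injective : ∀ {u v} → label (complete P) u ≡ label (complete P) v → u ≡ v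
      injective {u} {v} eq with code-injective (F.toℕ-injective (suc-injective eq))
      ... | eqp , eqs = trans (sym (code-pos-side u)) (trans (cong₂ code
              (F.toℕ-injective (nth-injective zero (complete-unique uP) (in-range (pos u)) (in-range (pos v)) eqp)) eqs)
              (code-pos-side v))

    label-V : ∀ L {x} → x < h → ∀ b → label L (V x b) ≡ suc (toℕ (code (nth zero L x) b))
    label-V L x<h b = cong₂ (λ x b → suc (toℕ (code (nth zero L x) b))) (pos-V x<h b) (side-V x<h b)

    module Views (r : ℕ) where

      -- One step moves by less than `e + e` positions, so this bounds the reach of `r` rounds.
      radius : ℕ
      radius = r * (e + e)

      -- The endpoint relative to `o` depends only on the port word and the side, which makes views
      -- at different offsets comparable. Starting at `radius + o` leaves room for all steps down,
      -- so positions never become negative.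
      walk-V : ∀ fs → All (_∈ ports) fs → length fs ≤ r → ∀ b →
        ∃ λ x → ∃ λ b' → radius ≤ x + length fs * (e + e) × x ≤ radius + length fs * (e + e) ×
          (∀ o → walk fs (V (radius + o) b) ≡ V (x + o) b')
      walk-V [] _ _ b = radius , b , m≤m+n radius 0 , m≤m+n radius 0 , λ _ → refl
      walk-V (f ∷ fs) (f∈ ∷ fs∈) lt b with walk-V fs fs∈ (≤-trans (n≤1+n _) lt) b | isPort f∈
      ... | x , b' , lo , hi , eq | isFlip _ refl =
        x , not b' ,
        ≤-trans lo (+-monoʳ-≤ x (m≤n+m _ (e + e))) ,
        ≤-trans hi (+-monoʳ-≤ radius (m≤n+m _ (e + e))) ,
        λ o → trans (cong flip (eq o)) (flip-V (x + o) b')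
      ... | x , b' , lo , hi , eq | isUp {j} j<e refl =
        k + x , b' ,
        ≤-trans lo (+-mono-≤ (m≤n+m x k) (m≤n+m _ (e + e))) ,
        ≤-trans (+-mono-≤ (<⇒≤ (step≤ j<e)) hi) (≤-reflexive (x∙yz≈y∙xz (e + e) radius (length fs * (e + e)))) ,
        λ o → trans (cong (up k) (eq o)) (trans (sym (V-+ k (x + o) b')) (cong (λ y → V y b') (sym (+-assoc k x o))))
        where
        k = suc (j + j)
      ... | x , b' , lo , hi , eq | isDown {j} j<e refl =
        x ∸ k , b' , lo' , ≤-trans (m∸n≤m x k) (≤-trans hi (+-monoʳ-≤ radius (m≤n+m _ (e + e)))) ,
        λ o → trans (cong (down k) (eq o)) (trans (cong (λ y → down k (V y b')) (trans (cong (_+ o) (sym k+)) (+-assoc k (x ∸ k) o)))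
          (down-V k (x ∸ k + o) b'))
        where
        k = suc (j + j)
        k≤ : k ≤ e + e
        k≤ = <⇒≤ (step≤ j<e)
        -- The bound `length fs < r` leaves one step of `radius` unspent, so `e + e ≤ x` and the
        -- subtraction `x ∸ k` is exact.
        k≤x : k ≤ x
        k≤x = ≤-trans k≤ (+-cancelʳ-≤ (length fs * (e + e)) (e + e) x (≤-trans (*-monoˡ-≤ (e + e) lt) lo))
        k+ : k + (x ∸ k) ≡ x
        k+ = m+[n∸m]≡n k≤x
        lo' : radius ≤ (x ∸ k) + (e + e + length fs * (e + e))
        lo' = ≤-trans lo (≤-trans (≤-reflexive (cong (_+ length fs * (e + e)) (trans (sym k+) (+-comm k (x ∸ k)))))
          (≤-trans (≤-reflexive (+-assoc (x ∸ k) k _)) (+-monoʳ-≤ (x ∸ k) (+-monoˡ-≤ _ k≤))))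

      module Outputs (A : LocalAlg (length ports) c (h * 2) r) where

        output : (P : List (Fin h)) → Unique P → Cut (h * 2)
        output P uP = out A G (labelling P uP)

        -- A walk of length at most `r` from position `radius + o` ends between `o` and
        -- `radius + radius + o`. That range lies below `h`, so no walk wraps and all identifiers
        -- seen can be read off the list.
        output-local : ∀ {P Q} (uP : Unique P) (uQ : Unique Q) {o o'} →
          radius + radius + o < h → radius + radius + o' < h →
          (∀ {x} → x ≤ radius + radius → nth zero (complete P) (x + o) ≡ nth zero (complete Q) (x + o')) →
          ∀ b → output P uP (V (radius + o) b) ≡ output Q uQ (V (radius + o') b)
        output-local {P} {Q} uP uQ {o} {o'} <h <h' agree b =
          local A G (labelling P uP) _ G (labelling Q uQ) _ inClass inClass
            (sameView {ι = labelling P uP} {ι' = labelling Q uQ} same)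
          where
          same : SameLabels r (labelling P uP) (V (radius + o) b) (labelling Q uQ) (V (radius + o') b)
          same fs fs∈ le with walk-V fs fs∈ le b
          ... | x , b' , _ , hi , eq =
            trans (cong (label (complete P)) (eq o)) (trans (label-V (complete P) (≤-<-trans (+-monoˡ-≤ o x≤) <h) b')
              (trans (cong (λ i → suc (toℕ (code i b'))) (agree x≤))
                (sym (trans (cong (label (complete Q)) (eq o')) (label-V (complete Q) (≤-<-trans (+-monoˡ-≤ o' x≤) <h') b')))))
            where
            x≤ : x ≤ radius + radius
            x≤ = ≤-trans hi (+-monoʳ-≤ radius (*-monoˡ-≤ (e + e) le))

-- Sums over blocks, and pairs of bits as colours

unique-++ʳ : ∀ {A : Set} (xs : List A) {ys} → Unique (xs ++ ys) → Unique ys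
unique-++ʳ []       u       = u
unique-++ʳ (x ∷ xs) (_ ∷ u) = unique-++ʳ xs u

unique-++ˡ : ∀ {A : Set} (xs : List A) {ys} → Unique (xs ++ ys) → Unique xs
unique-++ˡ []       u        = []
unique-++ˡ (x ∷ xs) (x≢ ∷ u) = All.++⁻ˡ xs x≢ ∷ unique-++ˡ xs u

sum-applyUpTo-+ : ∀ (f : ℕ → ℕ) a b →
  sum (applyUpTo f (a + b)) ≡ sum (applyUpTo f a) + sum (applyUpTo (λ x → f (a + x)) b)
sum-applyUpTo-+ f zero    b = refl
sum-applyUpTo-+ f (suc a) b = trans (cong (f 0 +_) (sum-applyUpTo-+ (f ∘ suc) a b)) (sym (+-assoc (f 0) _ _))

sum-applyUpTo-≤ : ∀ (f : ℕ → ℕ) n c → (∀ {x} → x < n → f x ≤ c) → sum (applyUpTo f n) ≤ n * c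
sum-applyUpTo-≤ f zero    c _  = z≤n
sum-applyUpTo-≤ f (suc n) c le = +-mono-≤ (le z<s) (sum-applyUpTo-≤ (f ∘ suc) n c (λ x<n → le (s<s x<n)))

sum-applyUpTo-blocks : ∀ (f : ℕ → ℕ) t l c →
  (∀ {a} → a < t → sum (applyUpTo (λ x → f (a * l + x)) l) ≤ c) → sum (applyUpTo f (t * l)) ≤ t * c
sum-applyUpTo-blocks f zero    l c _  = z≤n
sum-applyUpTo-blocks f (suc t) l c le = begin
  sum (applyUpTo f (l + t * l))   ≡⟨ cong (λ k → sum (applyUpTo f k)) (+-comm l (t * l)) ⟩
  sum (applyUpTo f (t * l + l))   ≡⟨ sum-applyUpTo-+ f (t * l) l ⟩
  sum (applyUpTo f (t * l)) + sum (applyUpTo (λ x → f (t * l + x)) l)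
    ≤⟨ +-mono-≤ (sum-applyUpTo-blocks f t l c (λ a<t → le (m<n⇒m<1+n a<t))) (le (n<1+n t)) ⟩
  t * c + c                       ≡⟨ +-comm (t * c) c ⟩
  c + t * c                       ∎
  where open ≤-Reasoning

bitFin-injective : ∀ {a b} → bitFin a ≡ bitFin b → a ≡ b
bitFin-injective {false} {false} _ = refl
bitFin-injective {true}  {true}  _ = refl

encode : Bool → Bool → Fin 4
encode a b = combine (bitFin a) (bitFin b)

encode-injective : ∀ {a b a' b'} → encode a b ≡ encode a' b' → a ≡ a' × b ≡ b'
encode-injective {a} {b} {a'} {b'} eq =
  bitFin-injective (F.combine-injectiveˡ (bitFin a) (bitFin b) (bitFin a') (bitFin b') eq) ,
  bitFin-injective (F.combine-injectiveʳ (bitFin a) (bitFin b) (bitFin a') (bitFin b') eq)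

-- Cuts produced on homogeneous segments

module CutBound (h' e : ℕ) (δ : Bool) (wide : (e + e) + (e + e) ≤ suc h') (c : ℕ) (1≤c : 1 ≤ c) (r : ℕ)
  (A : LocalAlg (length (LadderGraph.ports h' e δ wide)) c (suc h' * 2) r) (g : ℕ) where

  open Ladder h'
  open LadderGraph h' e δ wide
  open Views c 1≤c r
  open Outputs A
  open import Data.List.Relation.Unary.Unique.DecPropositional (F._≟_ {h}) using (unique?)

  width : ℕ
  width = radius + radius

  -- The tuple is laid on the rungs from `0` on and completed to a labelling; its colour is the pair
  -- of outputs at its middle rung, `radius`. Lists with repetitions give no labelling and get a
  -- dummy value.
  windowOutput : List (Fin h) → Fin 4
  windowOutput w with unique? w
  ... | yes u = encode (output w u (V (radius + 0) false)) (output w u (V (radius + 0) true))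
  ... | no _  = zero

  -- The equation is asked for every proof of uniqueness because `windowOutput` uses the one found
  -- by `unique?`.
  windowOutput-unique : ∀ {w} → Unique w → (S : Bool → Bool) →
    (∀ (u : Unique w) b → S b ≡ output w u (V (radius + 0) b)) → encode (S false) (S true) ≡ windowOutput w
  windowOutput-unique {w} uw S eq with unique? w
  ... | yes u = cong₂ encode (eq u false) (eq u true)
  ... | no ¬u = contradiction uw ¬u

  -- The parameter `g` lengthens the controlled part of a segment at will; the other `4e` positions
  -- make room for neighbours on either side.
  slack : ℕ
  slack = g + ((e + e) + (e + e))

  open Segments windowOutput width slack public

  module _ {P : List (Fin h)} (uP : Unique P) {o : ℕ} (at : SegmentAt o P) where

    open SegmentAt at
    open Segment segment

    -- The same window lies on the rungs from `i + o` on under `P` and from `0` on under its own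
    -- completion. Its middle vertices see nothing else, so locality equates their outputs.
    output-window : ∀ {i} → i ≤ suc slack →
      encode (output P uP (V (radius + (i + o)) false)) (output P uP (V (radius + (i + o)) true))
        ≡ windowOutput (window (suc width) i seg)
    output-window {i} i≤ = windowOutput-unique unique-w (λ b → output P uP (V (radius + (i + o)) b))
      (λ u b → output-local uP u fits fits-w agree b)
      where
      w rest pre post : List (Fin h)
      w = window (suc width) i seg
      rest = drop (suc width) (drop i seg)
      pre = before ++ take i seg
      post = rest ++ after
      P≡ : P ≡ pre ++ (w ++ post)
      P≡ = begin
        P                                              ≡⟨ split ⟩
        before ++ (seg ++ after)                       ≡⟨ cong (λ s → before ++ (s ++ after)) (window-split (suc width) i seg) ⟩
        before ++ ((take i seg ++ (w ++ rest)) ++ after) ≡⟨ cong (before ++_) (++-assoc (take i seg) (w ++ rest) after) ⟩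
        before ++ (take i seg ++ ((w ++ rest) ++ after)) ≡⟨ cong (λ s → before ++ (take i seg ++ s)) (++-assoc w rest after) ⟩
        before ++ (take i seg ++ (w ++ post))          ≡⟨ ++-assoc before (take i seg) (w ++ post) ⟨
        pre ++ (w ++ post)                             ∎
        where open ≡-Reasoning
      i+W≤ : i + suc width ≤ length seg
      i+W≤ = begin
        i + suc width              ≤⟨ +-monoˡ-≤ (suc width) i≤ ⟩
        suc slack + suc width      ≡⟨ +-comm (suc slack) (suc width) ⟩
        suc (width + suc slack)    ≡⟨ cong suc (+-suc width slack) ⟩
        segmentLength              ≡⟨ len ⟨
        length seg                 ∎
        where open ≤-Reasoning
      length-w : length w ≡ suc width
      length-w = length-take-≤ (suc width) (drop i seg) (length-drop-+ i seg i+W≤)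
      length-pre : length pre ≡ i + o
      length-pre = trans (length-++ before) (trans (cong₂ _+_ offset (length-take-≤ i seg (m+n≤o⇒m≤o i i+W≤))) (+-comm o i))
      unique-w : Unique w
      unique-w = unique-++ˡ w (unique-++ʳ pre (subst Unique P≡ uP))
      length≤ : ∀ {Q : List (Fin h)} → Unique Q → length Q ≤ h
      length≤ {Q} uQ = ≤-trans (m≤m+n (length Q) _) (≤-reflexive (length-complement uQ))
      fits-w : width + 0 < h
      fits-w = ≤-trans (≤-reflexive (trans (cong suc (+-identityʳ width)) (sym length-w))) (length≤ unique-w)
      fits : width + (i + o) < h
      fits = begin-strict
        width + (i + o)                        <⟨ n<1+n _ ⟩
        suc width + (i + o)                    ≡⟨ cong₂ _+_ (sym length-w) (sym length-pre) ⟩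
        length w + length pre                  ≡⟨ +-comm (length w) (length pre) ⟩
        length pre + length w                  ≤⟨ +-monoʳ-≤ (length pre) (m≤m+n (length w) (length post)) ⟩
        length pre + (length w + length post)  ≡⟨ cong (length pre +_) (length-++ w) ⟨
        length pre + length (w ++ post)        ≡⟨ length-++ pre ⟨
        length (pre ++ (w ++ post))            ≡⟨ cong length P≡ ⟨
        length P                               ≤⟨ length≤ uP ⟩
        h                                      ∎
        where open ≤-Reasoning
      agree : ∀ {x} → x ≤ width → nth zero (complete P) (x + (i + o)) ≡ nth zero (complete w) (x + 0)
      agree {x} x≤ = begin
        nth zero (P ++ complement P) (x + (i + o))
          ≡⟨ cong₂ (nth zero) (trans (cong (_++ complement P) P≡) (++-assoc pre (w ++ post) (complement P)))
                              (trans (+-comm x (i + o)) (cong (_+ x) (sym length-pre))) ⟩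
        nth zero (pre ++ ((w ++ post) ++ complement P)) (length pre + x)
          ≡⟨ nth-++ʳ zero pre x ⟩
        nth zero ((w ++ post) ++ complement P) x
          ≡⟨ cong (λ L → nth zero L x) (++-assoc w post (complement P)) ⟩
        nth zero (w ++ (post ++ complement P)) x
          ≡⟨ nth-++ˡ zero w x<w ⟩
        nth zero w x
          ≡⟨ nth-++ˡ zero w x<w ⟨
        nth zero (complete w) x
          ≡⟨ cong (nth zero (complete w)) (+-identityʳ x) ⟨
        nth zero (complete w) (x + 0) ∎
        where
        open ≡-Reasoning
        x<w : x < length w
        x<w = subst (x <_) (sym length-w) (s≤s x≤)

    output-constant : ∀ {z} → radius ≤ z → z ≤ radius + suc slack → ∀ b →
      output P uP (V (z + o) b) ≡ output P uP (V (radius + (0 + o)) b)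
    output-constant {z} lo hi b = trans (cong (λ y → output P uP (V y b)) z+o≡) (select b)
      where
      i = z ∸ radius
      z+o≡ : z + o ≡ radius + (i + o)
      z+o≡ = trans (cong (_+ o) (sym (m+[n∸m]≡n lo))) (+-assoc radius i o)
      i≤ : i ≤ suc slack
      i≤ = ≤-trans (∸-monoˡ-≤ radius hi) (≤-reflexive (m+n∸m≡n radius (suc slack)))
      both = encode-injective (trans (output-window i≤) (trans (homog i≤) (sym (output-window z≤n))))
      select : ∀ b → output P uP (V (radius + (i + o)) b) ≡ output P uP (V (radius + (0 + o)) b)
      select false = proj₁ both
      select true  = proj₂ both

    -- Every shift moves by less than `e + e` along the rail and so stays where the output is
    -- constant; only the rung can be cut.
    cutDegree-interior : ∀ {y} → radius + (e + e) ≤ y → y + (e + e) ≤ radius + suc slack → ∀ b →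
      cutDegree G (output P uP) (V (y + o) b) ≤ bit δ
    cutDegree-interior {y} lo hi b = cutDegree-shifts (output P uP) (V (y + o) b) same
      where
      y-const : output P uP (V (y + o) b) ≡ output P uP (V (radius + (0 + o)) b)
      y-const = output-constant (m+n≤o⇒m≤o radius lo) (m+n≤o⇒m≤o y hi) b
      same : ∀ {f} → f ∈ shifts e → output P uP (f (V (y + o) b)) ≡ output P uP (V (y + o) b)
      same f∈ with ∈-shifts⁻ f∈
      ... | j , j<e , inj₁ refl = trans (cong (output P uP) (trans (sym (V-+ k (y + o) b)) (cong (λ x → V x b) (sym (+-assoc k y o)))))
              (trans (output-constant (≤-trans (m+n≤o⇒m≤o radius lo) (m≤n+m y k))
                (≤-trans (≤-trans (≤-reflexive (+-comm k y)) (+-monoʳ-≤ y (<⇒≤ (step≤ j<e)))) hi) b) (sym y-const))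
        where k = suc (j + j)
      ... | j , j<e , inj₂ refl = trans (cong (output P uP) (trans (cong (λ x → down k (V x b)) y+o≡) (down-V k (y ∸ k + o) b)))
              (trans (output-constant r≤ (≤-trans (m∸n≤m y k) (m+n≤o⇒m≤o y hi)) b) (sym y-const))
        where
        k = suc (j + j)
        r+k≤y : radius + k ≤ y
        r+k≤y = ≤-trans (+-monoʳ-≤ radius (<⇒≤ (step≤ j<e))) lo
        r≤ : radius ≤ y ∸ k
        r≤ = ≤-trans (≤-reflexive (sym (m+n∸n≡m radius k))) (∸-monoˡ-≤ k r+k≤y)
        y+o≡ : y + o ≡ k + (y ∸ k + o)
        y+o≡ = trans (cong (_+ o) (sym (m+[n∸m]≡n (m+n≤o⇒n≤o radius r+k≤y)))) (+-assoc k (y ∸ k) o)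

  -- The first `radius` positions lack a full window inside the segment, and the next `e + e` may
  -- have a neighbour among them; likewise at the other end.
  margin : ℕ
  margin = radius + (e + e)

  blockBound : ℕ
  blockBound = margin * length ports + ((2 + g) * bit δ + margin * length ports)

  segmentLength≡ : segmentLength ≡ margin + ((2 + g) + margin)
  segmentLength≡ = lemma radius g (e + e)
    where
    lemma : ∀ R g E → suc (suc (R + R + (g + (E + E)))) ≡ (R + E) + ((2 + g) + (R + E))
    lemma = solve-∀

  block-≤ : ∀ {P} (uP : Unique P) {o} → SegmentAt o P → ∀ b →
    sum (applyUpTo (λ x → cutDegree G (output P uP) (V (o + x) b)) segmentLength) ≤ blockBound
  block-≤ {P} uP {o} at b = begin
    sum (applyUpTo f segmentLength)                  ≡⟨ cong (λ k → sum (applyUpTo f k)) segmentLength≡ ⟩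
    sum (applyUpTo f (margin + ((2 + g) + margin)))  ≡⟨ sum-applyUpTo-+ f margin _ ⟩
    sum (applyUpTo f margin) + sum (applyUpTo f₁ ((2 + g) + margin))
      ≡⟨ cong (sum (applyUpTo f margin) +_) (sum-applyUpTo-+ f₁ (2 + g) margin) ⟩
    sum (applyUpTo f margin) + (sum (applyUpTo f₁ (2 + g)) + sum (applyUpTo f₂ margin))
      ≤⟨ +-mono-≤ (sum-applyUpTo-≤ f margin _ (λ _ → cutDegree≤ S _))
           (+-mono-≤ (sum-applyUpTo-≤ f₁ (2 + g) _ middle) (sum-applyUpTo-≤ f₂ margin _ (λ _ → cutDegree≤ S _))) ⟩
    blockBound ∎
    where
    open ≤-Reasoning
    S = output P uP
    f f₁ f₂ : ℕ → ℕ
    f x = cutDegree G S (V (o + x) b)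
    f₁ x = f (margin + x)
    f₂ x = f₁ ((2 + g) + x)
    middle : ∀ {x} → x < 2 + g → f₁ x ≤ bit δ
    middle {x} (s≤s x≤) = subst (λ k → cutDegree G S (V k b) ≤ bit δ) (+-comm (margin + x) o)
      (cutDegree-interior uP at (m≤m+n margin x)
        (≤-trans (+-monoˡ-≤ (e + e) (+-monoʳ-≤ margin x≤)) (≤-reflexive (lemma radius g (e + e)))) b)
      where
      lemma : ∀ R g E → R + E + (1 + g) + E ≡ R + suc (g + (E + E))
      lemma = solve-∀

  -- Margins, and all positions behind the last segment, are charged the full degree; the remaining
  -- ones at most `bit δ` each.
  track-≤ : ∀ {P} (uP : Unique P) {t rest} → (∀ {a} → a < t → SegmentAt (a * segmentLength) P) →
    h ≡ t * segmentLength + rest → ∀ b →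
    sum (applyUpTo (λ x → cutDegree G (output P uP) (V x b)) h)
      ≤ h * bit δ + (t * (margin + margin) + rest) * length ports
  track-≤ {P} uP {t} {rest} at h≡ b = begin
    sum (applyUpTo f h)                           ≡⟨ cong (λ k → sum (applyUpTo f k)) h≡ ⟩
    sum (applyUpTo f (t * segmentLength + rest))  ≡⟨ sum-applyUpTo-+ f (t * segmentLength) rest ⟩
    sum (applyUpTo f (t * segmentLength)) + sum (applyUpTo (λ x → f (t * segmentLength + x)) rest)
      ≤⟨ +-mono-≤ (sum-applyUpTo-blocks f t segmentLength blockBound (λ a<t → block-≤ uP (at a<t) b))
                  (sum-applyUpTo-≤ _ rest (length ports) (λ _ → cutDegree≤ (output P uP) _)) ⟩
    t * blockBound + rest * length ports          ≡⟨ lemma t margin (length ports) (2 + g) (bit δ) rest ⟩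
    t * (2 + g) * bit δ + (t * (margin + margin) + rest) * length ports
      ≤⟨ +-monoˡ-≤ _ (*-monoˡ-≤ (bit δ) (≤-trans (*-monoʳ-≤ t 2+g≤) (≤-trans (m≤m+n _ rest) (≤-reflexive (sym h≡))))) ⟩
    h * bit δ + (t * (margin + margin) + rest) * length ports ∎
    where
    open ≤-Reasoning
    f : ℕ → ℕ
    f x = cutDegree G (output P uP) (V x b)
    lemma : ∀ t p D q δ s → t * (p * D + (q * δ + p * D)) + s * D ≡ t * q * δ + (t * (p + p) + s) * D
    lemma = solve-∀
    2+g≤ : 2 + g ≤ segmentLength
    2+g≤ = ≤-trans (≤-trans (m≤m+n (2 + g) margin) (m≤n+m _ margin)) (≤-reflexive (sym segmentLength≡))

  -- The handshake doubles the cut and the two rails double the bound, so the factors cancel.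
  small-cut : ∀ {t rest} → t * segmentLength + poolSize ≤ h → h ≡ t * segmentLength + rest →
    ∃ λ ι → cutSize G (out A G ι) ≤ h * bit δ + (t * (margin + margin) + rest) * length ports
  small-cut {t} {rest} room h≡ with segments t room
  ... | P , uP , _ , at = labelling c 1≤c P uP , *-cancelˡ-≤ 2 (begin
    2 * cutSize G S                           ≡⟨ cong (cutSize G S +_) (+-identityʳ _) ⟩
    cutSize G S + cutSize G S                 ≡⟨ handshake G S ⟩
    sum (map (cutDegree G S) (allFin (h * 2))) ≡⟨ sum-tracks (cutDegree G S) ⟩
    _                                         ≤⟨ +-mono-≤ (track-≤ uP at h≡ false) (track-≤ uP at h≡ true) ⟩
    bound + bound                             ≡⟨ cong (bound +_) (+-identityʳ bound) ⟨
    2 * bound                                 ∎)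
    where
    open ≤-Reasoning
    S = output P uP
    bound = h * bit δ + (t * (margin + margin) + rest) * length ports

  max-cut : cutSize G colour ≡ h * length ports
  max-cut = *-cancelˡ-≡ _ _ 2 (trans (cong (cutSize G colour +_) (+-identityʳ _))
    (trans 2cut-col (lemma h (length ports))))
    where
    lemma : ∀ h D → h * 2 * D ≡ 2 * (h * D)
    lemma = solve-∀

-- Rational estimates

toℚᵘ-toℚ : ∀ m → toℚᵘ (toℚ m) ℚᵘ.≃ mkℚᵘ (ℤ.+ m) 0
toℚᵘ-toℚ m = ℚ.toℚᵘ-fromℚᵘ (mkℚᵘ (ℤ.+ m) 0)

toℚ-mono-≤ : ∀ {m n} → m ≤ n → toℚ m ℚ.≤ toℚ n
toℚ-mono-≤ {m} {n} m≤n = ℚ.toℚᵘ-cancel-≤ (ℚᵘ.≤-respˡ-≃ (ℚᵘ.≃-sym (toℚᵘ-toℚ m)) (ℚᵘ.≤-respʳ-≃ (ℚᵘ.≃-sym (toℚᵘ-toℚ n))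
  (*≤* (ℤ.*-monoʳ-≤-nonNeg (ℤ.+ 1) (ℤ.+≤+ m≤n)))))

toℚ-homo-+ : ∀ m n → toℚ (m + n) ≡ toℚ m ℚ.+ toℚ n
toℚ-homo-+ m n = ℚ.toℚᵘ-injective (begin
  toℚᵘ (toℚ (m + n))               ≈⟨ toℚᵘ-toℚ (m + n) ⟩
  mkℚᵘ (ℤ.+ (m + n)) 0               ≈⟨ *≡* (cong (ℤ._* ℤ.+ 1) (trans (ℤ.pos-+ m n) (sym (cong₂ ℤ._+_ (ℤ.*-identityʳ (ℤ.+ m)) (ℤ.*-identityʳ (ℤ.+ n)))))) ⟩
  mkℚᵘ (ℤ.+ m) 0 ℚᵘ.+ mkℚᵘ (ℤ.+ n) 0   ≈⟨ ℚᵘ.+-cong (toℚᵘ-toℚ m) (toℚᵘ-toℚ n) ⟨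
  toℚᵘ (toℚ m) ℚᵘ.+ toℚᵘ (toℚ n)   ≈⟨ ℚ.toℚᵘ-homo-+ (toℚ m) (toℚ n) ⟨
  toℚᵘ (toℚ m ℚ.+ toℚ n)           ∎)
  where open import Relation.Binary.Reasoning.Setoid ℚᵘ.≃-setoid

recip-*-toℚ : ∀ d m → recip (suc d) ℚ.* toℚ (m * suc d) ≡ toℚ m
recip-*-toℚ d m = ℚ.toℚᵘ-injective (begin
  toℚᵘ (recip (suc d) ℚ.* toℚ (m * suc d))          ≈⟨ ℚ.toℚᵘ-homo-* (recip (suc d)) (toℚ (m * suc d)) ⟩
  toℚᵘ (recip (suc d)) ℚᵘ.* toℚᵘ (toℚ (m * suc d))  ≈⟨ ℚᵘ.*-cong (ℚ.toℚᵘ-fromℚᵘ (mkℚᵘ (ℤ.+ 1) d)) (toℚᵘ-toℚ (m * suc d)) ⟩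
  mkℚᵘ (ℤ.+ 1) d ℚᵘ.* mkℚᵘ (ℤ.+ (m * suc d)) 0          ≈⟨ *≡* cross ⟩
  mkℚᵘ (ℤ.+ m) 0                                      ≈⟨ toℚᵘ-toℚ m ⟨
  toℚᵘ (toℚ m)                                      ∎)
  where
  open import Relation.Binary.Reasoning.Setoid ℚᵘ.≃-setoid
  cross : (ℤ.+ 1 ℤ.* ℤ.+ (m * suc d)) ℤ.* ℤ.+ 1 ≡ ℤ.+ m ℤ.* ℤ.+ suc (d * 1)
  cross = trans (ℤ.*-identityʳ _) (trans (ℤ.*-identityˡ _) (trans (ℤ.pos-* m (suc d))
    (cong (λ k → ℤ.+ m ℤ.* ℤ.+ suc k) (sym (*-identityʳ d)))))

-- A positive rational has numerator at least 1, hence is at least the reciprocal of its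
-- denominator.
denominator-bound : ∀ ε → 0ℚ ℚ.< ε → ∀ {x y} → ε ℚ.* toℚ x ℚ.≤ toℚ y → x ≤ ℚ.↧ₙ ε * y
denominator-bound (mkℚ (ℤ.+ zero) d cop) (ℚ.*<* (ℤ.+<+ ()))
denominator-bound (mkℚ ℤ.-[1+ _ ] d cop) (ℚ.*<* ())
denominator-bound ε@(mkℚ (ℤ.+ suc k) d cop) _ {x} {y} le
  with ℚᵘ.≤-respˡ-≃ (ℚᵘ.≃-trans (ℚ.toℚᵘ-homo-* ε (toℚ x)) (ℚᵘ.*-cong (ℚᵘ.≃-refl {toℚᵘ ε}) (toℚᵘ-toℚ x)))
         (ℚᵘ.≤-respʳ-≃ (toℚᵘ-toℚ y) (ℚ.toℚᵘ-mono-≤ le))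
... | *≤* le' = begin
  x              ≤⟨ m≤m+n x (k * x) ⟩
  suc k * x      ≤⟨ ℤ.drop‿+≤+ (subst₂ ℤ._≤_ left right le') ⟩
  y * suc d      ≡⟨ *-comm y (suc d) ⟩
  suc d * y      ∎
  where
  open ≤-Reasoning
  left : (ℤ.+ suc k ℤ.* ℤ.+ x) ℤ.* ℤ.+ 1 ≡ ℤ.+ (suc k * x)
  left = trans (ℤ.*-identityʳ _) (sym (ℤ.pos-* (suc k) x))
  right : ℤ.+ y ℤ.* ℤ.+ suc (d * 1) ≡ ℤ.+ (y * suc d)
  right = trans (cong (λ k → ℤ.+ y ℤ.* ℤ.+ suc k) (*-identityʳ d)) (sym (ℤ.pos-* y (suc d)))

-- Tower estimates

double≤2^ : ∀ n → suc n + suc n ≤ 2 ^ suc n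
double≤2^ n = subst (suc n + suc n ≤_) (cong (λ k → 2 ^ n + k) (sym (+-identityʳ (2 ^ n)))) (+-mono-≤ (n<2^n n) (n<2^n n))

-- Two more levels absorb a product, through `X ≤ 2 ^ X` and, as `X ≥ 1`, `X + X ≤ 2 ^ X`.
tower-square : ∀ s → tower s * (tower s + tower s) ≤ tower (2 + s)
tower-square s = begin
  X * (X + X)       ≤⟨ *-mono-≤ (<⇒≤ (n<2^n X)) 2X≤ ⟩
  2 ^ X * 2 ^ X     ≡⟨ ^-distribˡ-+-* 2 X X ⟨
  2 ^ (X + X)       ≤⟨ ^-monoʳ-≤ 2 2X≤ ⟩
  2 ^ (2 ^ X)       ∎
  where
  open ≤-Reasoning
  X = tower s
  2X≤ : X + X ≤ 2 ^ X
  2X≤ with tower s | tower-mono {0} {s} z≤n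
  ... | suc n | _ = double≤2^ n

-- Choice of the parameters

module Sizes (e q : ℕ) where

  -- Coefficients of the tower height `2 + s` below as a linear function of `r`.
  slope intercept : ℕ
  slope     = 4 * (e + e) + 16 * q * (e + e)
  intercept = 8 + 4 * q + 16 * q * (e + e) + 8 * (e + e)

  module _ (r : ℕ) where

    private
      E W p g m ℓ N i s : ℕ
      E = e + e
      W = r * E + r * E
      p = r * E + E
      -- With this choice `2 * q` times the two margins `p + p` is exactly `g`, which is less than
      -- the segment length `ℓ`.
      g = 4 * q * p
      m = g + (E + E)
      ℓ = suc (suc (W + m))
      N = suc (iterExp (W + m) (4 ^ suc m))
      -- Since `k < tower k`, the number `4 ^ suc m` is at most the tower at `suc (2 * suc m)`.
      -- Iterated exponentials add `W + m` levels, and a last one absorbs the `suc` in `N`.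
      i = suc (W + m + suc (2 * suc m))
      s = i + ℓ + 4 * q

    pool≤ : N ≤ tower i
    pool≤ = <-≤-trans (s≤s (iterExp-tower (W + m) 4^≤)) (n<2^n (tower (W + m + suc (2 * suc m))))
      where
      4^≤ : 4 ^ suc m ≤ tower (suc (2 * suc m))
      4^≤ = ≤-trans (≤-reflexive (^-*-assoc 2 2 (suc m))) (^-monoʳ-≤ 2 (<⇒≤ (n<tower (2 * suc m))))

    -- Pool and one further segment fill less than a `1/(2q)` share of the rungs; `tower s` bounds
    -- each of `4 * q`, `N` and `ℓ`.
    room : ∀ {h} → tower (slope * r + intercept) < h * 2 → 2 * q * (N + ℓ) < h
    room {h} lt = *-cancelʳ-< 2 _ h (begin-strict
      2 * q * (N + ℓ) * 2             ≡⟨ rearrange q (N + ℓ) ⟩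
      4 * q * (N + ℓ)                 ≤⟨ *-mono-≤ (below (m≤n+m (4 * q) (i + ℓ))) (+-mono-≤
                                           (≤-trans pool≤ (tower-mono (≤-trans (m≤m+n i ℓ) (m≤m+n (i + ℓ) (4 * q)))))
                                           (below (≤-trans (m≤n+m ℓ i) (m≤m+n (i + ℓ) (4 * q))))) ⟩
      tower s * (tower s + tower s)   ≤⟨ tower-square s ⟩
      tower (2 + s)                   ≡⟨ cong tower (linear r q E) ⟩
      tower (slope * r + intercept)   <⟨ lt ⟩
      h * 2                           ∎)
      where
      open ≤-Reasoning
      below : ∀ {k} → k ≤ s → k ≤ tower s
      below {k} k≤s = ≤-trans (<⇒≤ (n<tower k)) (tower-mono k≤s)
      rearrange : ∀ q x → 2 * q * x * 2 ≡ 4 * q * x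
      rearrange = solve-∀
      linear : ∀ r q E →
        2 + (suc (r * E + r * E + (4 * q * (r * E + E) + (E + E)) + suc (2 * suc (4 * q * (r * E + E) + (E + E))))
             + suc (suc (r * E + r * E + (4 * q * (r * E + E) + (E + E)))) + 4 * q)
        ≡ (4 * E + 16 * q * E) * r + (8 + 4 * q + 16 * q * E + 8 * E)
      linear = solve-∀

-- From small cuts to the round lower bound

blocks : ∀ {h} N ℓ .{{_ : NonZero ℓ}} → N ≤ h →
  ∃ λ t → ∃ λ rest → t * ℓ + N ≤ h × h ≡ t * ℓ + rest × rest ≤ N + ℓ
blocks {h} N ℓ N≤h = t , N + x , ≤-trans (+-monoʳ-≤ (t * ℓ) (m≤m+n N x)) (≤-reflexive (sym h≡)) , h≡ ,
    +-monoʳ-≤ N (<⇒≤ (m%n<n (h ∸ N) ℓ))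
  where
  -- The pool is set aside before dividing, so that the last extraction still finds it; it joins the
  -- remainder in `rest`.
  t = (h ∸ N) / ℓ
  x = (h ∸ N) % ℓ
  h≡ : h ≡ t * ℓ + (N + x)
  h≡ = trans (sym (m+[n∸m]≡n N≤h)) (trans (cong (N +_) (m≡m%n+[m/n]*n (h ∸ N) ℓ)) (rotate N x (t * ℓ)))
    where
    rotate : ∀ a b c → a + (b + c) ≡ c + (a + b)
    rotate = solve-∀

-- All that the final contradiction needs from the construction: `b` cut edges per rung, plus `d`
-- for each wasted position, with fewer than a `1/q` share wasted.
record SmallCut {d c n r : ℕ} (A : LocalAlg d c n r) (h b q : ℕ) : Set where
  field
    G      : Graph n
    ι      : IdAssignment n c
    S      : Cut n
    waste  : ℕ
    class  : InClass d G
    large  : cutSize G S ≡ h * d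
    small  : cutSize G (out A G ι) ≤ h * b + waste * d
    sparse : q * waste < h

module _ (e : ℕ) (δ : Bool) (c : ℕ) (1≤c : 1 ≤ c) (q : ℕ) .{{_ : NonZero q}} where

  open Sizes e q

  smallCut : ∀ h r (A : LocalAlg (bit δ + (e + e)) c (h * 2) r) →
    tower (slope * r + intercept) < h * 2 → SmallCut A h (bit δ) q
  smallCut (suc h') r = λ A lt → subst Claim (LadderGraph.length-ports h' e δ (wide lt)) (claim lt) A
    where
    h E p g ℓ N : ℕ
    h = suc h'
    E = e + e
    p = r * E + E
    g = 4 * q * p
    ℓ = suc (suc (r * E + r * E + (g + (E + E))))
    N = suc (iterExp (r * E + r * E + (g + (E + E))) (4 ^ suc (g + (E + E))))
    -- The type of the algorithm mentions the degree, so it is quantified inside the claim for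
    -- `length-ports` to be rewritten.
    Claim : ℕ → Set
    Claim d = (A : LocalAlg d c (h * 2) r) → SmallCut A h (bit δ) q
    module _ (lt : tower (slope * r + intercept) < h * 2) where
      N+ℓ< : 2 * q * (N + ℓ) < h
      N+ℓ< = room r lt
      N+ℓ≤ : N + ℓ ≤ h
      N+ℓ≤ = ≤-trans (m≤n*m (N + ℓ) (2 * q) {{m*n≢0 2 q}}) (<⇒≤ N+ℓ<)
      wide : E + E ≤ h
      wide = ≤-trans (≤-trans (m≤n+m (E + E) (2 + (r * E + r * E) + g)) (≤-reflexive (assoc₃ (r * E + r * E) g (E + E))))
        (≤-trans (m≤n+m ℓ N) N+ℓ≤)
        where
        assoc₃ : ∀ a b c → 2 + a + b + c ≡ suc (suc (a + (b + c)))
        assoc₃ = solve-∀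
      claim : Claim (length (LadderGraph.ports h' e δ wide))
      claim A = assemble (blocks N ℓ (≤-trans (m≤m+n N ℓ) N+ℓ≤))
        where
        open ≤-Reasoning
        expand : ∀ q t p x → 2 * (q * (t * (p + p) + x)) ≡ t * (4 * q * p) + 2 * q * x
        expand = solve-∀
        g≤ℓ : g ≤ ℓ
        g≤ℓ = ≤-trans (m≤m+n g (E + E)) (m≤n+m (g + (E + E)) (2 + (r * E + r * E)))
        -- After doubling, the margins cost `t * g`, at most `h` because `g ≤ ℓ`, and the rest costs
        -- less than `h` by `room`.
        sparse : ∀ {t rest} → h ≡ t * ℓ + rest → rest ≤ N + ℓ → q * (t * (p + p) + rest) < h
        sparse {t} {rest} h≡ rest≤ = *-cancelˡ-< 2 _ h (begin-strict
          2 * (q * (t * (p + p) + rest))   ≡⟨ expand q t p rest ⟩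
          t * g + 2 * q * rest             ≤⟨ +-mono-≤ (*-monoʳ-≤ t g≤ℓ) (*-monoʳ-≤ (2 * q) rest≤) ⟩
          t * ℓ + 2 * q * (N + ℓ)          <⟨ +-mono-≤-< (≤-trans (m≤m+n (t * ℓ) rest) (≤-reflexive (sym h≡))) N+ℓ< ⟩
          h + h                            ≡⟨ cong (λ k → h + k) (+-identityʳ h) ⟨
          2 * h                            ∎)
        assemble : (∃ λ t → ∃ λ rest → t * ℓ + N ≤ h × h ≡ t * ℓ + rest × rest ≤ N + ℓ) → SmallCut A h (bit δ) q
        assemble (t , rest , fits , h≡ , rest≤) = record
          { G = LadderGraph.G h' e δ wide ; ι = proj₁ cut ; S = Ladder.colour h' ; waste = t * (p + p) + rest
          ; class = LadderGraph.inClass h' e δ wide ; large = CutBound.max-cut h' e δ wide c 1≤c r A g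
          ; small = proj₂ cut ; sparse = sparse {t} {rest} h≡ rest≤ }
          where cut = CutBound.small-cut h' e δ wide c 1≤c r A g {t} {rest} fits h≡

  logStar-bound : ∀ (ρ : ℚ) →
    (∀ {h r} (A : LocalAlg (bit δ + (e + e)) c (h * 2) r) → Approx ρ A → ¬ SmallCut A h (bit δ) q) →
    RoundLowerBound (bit δ + (e + e)) c ρ
  -- For `r ≥ 1` the height `slope * r + intercept` is at most `(slope + intercept) * r`. At `r = 0`
  -- this product vanishes, and the threshold on `n` takes over.
  logStar-bound ρ refute = slope + intercept , suc (tower intercept) , bound
    where
    big : ∀ {n} r → suc (tower intercept) ≤ n → (slope + intercept) * r < logStar n → tower (slope * r + intercept) < n
    big zero n₀≤n _ = ≤-trans (≤-reflexive (cong (λ k → suc (tower (k + intercept))) (*-zeroʳ slope))) n₀≤n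
    big (suc r) _ lt = ≤-<-trans (tower-mono (≤-trans (+-monoʳ-≤ (slope * suc r) (m≤m*n intercept (suc r)))
      (≤-reflexive (sym (*-distribʳ-+ (suc r) slope intercept))))) (tower<-of-<logStar lt)
    bound : ∀ n → suc (tower intercept) ≤ n → n % 2 ≡ 0 → ∀ r (A : LocalAlg (bit δ + (e + e)) c n r) →
      Approx ρ A → logStar n ≤ (slope + intercept) * r
    bound n n₀≤n even r A approx =
      ≮⇒≥ λ lt → impossible {h = n / 2} (trans (m≡m%n+[m/n]*n n 2) (cong (_+ (n / 2) * 2) even)) A approx (big r n₀≤n lt)
      where
      impossible : ∀ {n h} → n ≡ h * 2 → (A : LocalAlg (bit δ + (e + e)) c n r) → Approx ρ A →
        ¬ tower (slope * r + intercept) < n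
      impossible {h = h} refl A approx lt = refute A approx (smallCut h r A lt)

half : ∀ d → d ≡ d % 2 + (d / 2 + d / 2)
half d = trans (m≡m%n+[m/n]*n d 2) (cong (d % 2 +_) (double (d / 2)))
  where
  double : ∀ k → k * 2 ≡ k + k
  double = solve-∀

approx-col : ∀ {d c n r h b q} {ρ : ℚ} {A : LocalAlg d c n r} → Approx ρ A → (s : SmallCut A h b q) →
  ρ ℚ.* toℚ (h * d) ℚ.≤ toℚ (h * b + SmallCut.waste s * d)
approx-col {ρ = ρ} approx s = ℚ.≤-trans
  (ℚ.≤-reflexive (cong (λ k → ρ ℚ.* toℚ k) (sym large)))
  (ℚ.≤-trans (approx G ι class S) (toℚ-mono-≤ small))
  where open SmallCut s

-- As `ε` is at least the reciprocal of its denominator, cancelling `d` forces `h ≤ ↧ₙ ε * x`,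
-- against sparsity with `q = ↧ₙ ε`.
no-small-cut : ∀ {h d x} ε → 0ℚ ℚ.< ε → .{{_ : NonZero d}} →
  ε ℚ.* toℚ (h * d) ℚ.≤ toℚ (x * d) → ¬ ℚ.↧ₙ ε * x < h
no-small-cut {h} {d} {x} ε 0<ε le lt = contradiction lt (≤⇒≯ (*-cancelʳ-≤ h (ℚ.↧ₙ ε * x) d
  (≤-trans (denominator-bound ε 0<ε le) (≤-reflexive (sym (*-assoc (ℚ.↧ₙ ε) x d))))))

theorem2 : ∀ (d : ℕ) → 2 ≤ d → ∀ (c : ℕ) → 1 ≤ c →
    ((d % 2 ≡ 0) → ∀ (ρ : ℚ) → 0ℚ ℚ.< ρ → RoundLowerBound d c ρ)
    × ((d % 2 ≡ 1) → ∀ (ε : ℚ) → 0ℚ ℚ.< ε → RoundLowerBound d c (recip d ℚ.+ ε))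
theorem2 d@(suc d-1) 2≤d c 1≤c = even , odd′
  where
  e = d / 2
  even : d % 2 ≡ 0 → ∀ ρ → 0ℚ ℚ.< ρ → RoundLowerBound d c ρ
  even d%2≡0 ρ 0<ρ = subst (λ k → RoundLowerBound k c ρ) (sym d≡)
      (logStar-bound e false c 1≤c (ℚ.↧ₙ ρ) ρ refute)
    where
    d≡ : d ≡ e + e
    d≡ = trans (half d) (cong (_+ (e + e)) d%2≡0)
    refute : ∀ {h r} (A : LocalAlg (e + e) c (h * 2) r) → Approx ρ A → ¬ SmallCut A h 0 (ℚ.↧ₙ ρ)
    refute {h} A approx s = no-small-cut ρ 0<ρ {{subst NonZero d≡ _}}
      (subst (λ k → ρ ℚ.* toℚ (h * (e + e)) ℚ.≤ toℚ (k + waste * (e + e))) (*-zeroʳ h) (approx-col {ρ = ρ} {A} approx s)) sparse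
      where open SmallCut s
  odd′ : d % 2 ≡ 1 → ∀ ε → 0ℚ ℚ.< ε → RoundLowerBound d c (recip d ℚ.+ ε)
  odd′ d%2≡1 ε 0<ε = subst (λ k → RoundLowerBound k c (recip d ℚ.+ ε)) (sym d≡)
      (logStar-bound e true c 1≤c (ℚ.↧ₙ ε) (recip d ℚ.+ ε) refute)
    where
    d≡ : d ≡ suc (e + e)
    d≡ = trans (half d) (cong (_+ (e + e)) d%2≡1)
    refute : ∀ {h r} (A : LocalAlg (suc (e + e)) c (h * 2) r) → Approx (recip d ℚ.+ ε) A → ¬ SmallCut A h 1 (ℚ.↧ₙ ε)
    refute {h} A approx s = no-small-cut ε 0<ε (ℚ.≮⇒≥ λ lt → ℚ.<-irrefl refl (ℚ.<-≤-trans (ℚ.+-monoʳ-< (toℚ h) lt) le)) sparse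
      where
      open SmallCut s
      D = suc (e + e)
      -- The share `1/d` of the `h * D` edges is exactly `h`, the allowance for cut rungs; it
      -- cancels and only the `ε` part remains.
      le : toℚ h ℚ.+ ε ℚ.* toℚ (h * D) ℚ.≤ toℚ h ℚ.+ toℚ (waste * D)
      le = subst₂ ℚ._≤_
        (trans (ℚ.*-distribʳ-+ (toℚ (h * D)) (recip d) ε) (cong (ℚ._+ ε ℚ.* toℚ (h * D))
          (trans (cong (λ k → recip k ℚ.* toℚ (h * D)) d≡) (recip-*-toℚ (e + e) h))))
        (trans (cong (λ k → toℚ (k + waste * D)) (*-identityʳ h)) (toℚ-homo-+ h (waste * D)))
        (approx-col {ρ = recip d ℚ.+ ε} {A} approx s)
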